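{- There exist absolute constants $c>0$ and $\delta_0>0$ such that for every $0<\delta\le\delta_0$ there is a weighted graph $G$ such that for any weight partition $[\ell_1,r_1),[\ell_2,r_2),\dots,[\ell_k,r_k)\subseteq\mathbb{R}$ of $G$, the following holds: if all possible choices of maximum weight matchings $M_i$ of $G_{[\ell_i,r_i)}$ ($i=1,\dots,k$) satisfy $$\mu_w(M_1\cup M_2\cup\dots\cup M_k)\ge(1-\delta)\cdot\mu_w(G),$$ then there is a weight class $[\ell_i,r_i)$ such that $r_i\ge\ell_i\cdot\exp(c\,\delta^{ -1})$.
   Context: $G=(V,E)$ is a finite undirected graph with edge weights $w:E\to[1,W]$ for some $W$ (which may depend on $\delta$). A matching is a set of vertex-disjoint edges; $w(M)=\sum_{e\in M}w(e)$; $\mu_w(H)$ is the maximum of $w(M)$ over matchings $M$ in $H$. For $I\subseteq\mathbb{R}$, $G_I$ is the subgraph of $G$ consisting of the edges $e$ with $w(e)\in I$. Intervals $[\ell_1,r_1),\dots,[\ell_k,r_k)$ (with $\ell_1>0$) form a weight partition if $\ell_{i+1}=r_i$ for all $1\le i\le k-1$ and they cover $[1,W]$. -}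

module Defs where

import Data.Rational as Rat

open import Algebra.Definitions.RawSemiring Rat.+-*-rawSemiring using (_^_)
open import Data.Bool using (if_then_else_)
open import Data.Fin as Fin using (Fin; inject₁)
open import Data.Fin.Properties using (all?)
open import Data.Fin.Subset using (Subset; inside; outside; _∈_)
open import Data.Fin.Subset.Properties using (_∈?_)
import Data.Integer.Base as ℤ
import Data.Integer.Properties as ℤₚ
open import Data.List as List using (List; []; _∷_; _++_; filter)
open import Data.Nat as ℕ using (ℕ; zero; suc; _!)
import Data.Nat.Coprimality as Coprime
import Data.Nat.Properties as ℕₚ
open import Data.Product using (∃-syntax; _×_; _,_; proj₁; proj₂)
open Rat using (ℚ; 0ℚ; 1ℚ)
import Data.Rational.Properties as ℚₚ
open import Data.Rational.Solver using (module +-*-Solver)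
open import Data.Sum using (_⊎_; inj₁; inj₂; [_,_]′)
open import Data.Vec using (lookup; []; _∷_)
open import Data.Vec.Functional using (foldr)
open import Function.Definitions using (Injective)
open import Level using (0ℓ)
open import Relation.Binary.PropositionalEquality
  using (_≡_; _≢_; refl; sym; trans; cong; cong₂; subst; subst₂)
open import Relation.Nullary using (¬_; Dec; yes; no; contradiction; ¬?)
open import Relation.Nullary.Decidable using (_×-dec_; _⊎-dec_; _→-dec_)
open import Relation.Unary using (Pred; Decidable)

module RationalLemmas where
  open Rat hiding (ℚ; 0ℚ; 1ℚ)
  open ℚₚ
  open +-*-Solver
  open ≤-Reasoning

  0<1 : 0ℚ < 1ℚ
  0<1 = *<* (ℤ.+<+ (ℕ.s≤s ℕ.z≤n))

  0≤1 : 0ℚ ≤ 1ℚ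
  0≤1 = *≤* (ℤ.+≤+ ℕ.z≤n)

  *-monoˡ : ∀ {p q r} → 0ℚ ≤ r → p ≤ q → r * p ≤ r * q
  *-monoˡ {r = r} 0≤r = *-monoˡ-≤-nonNeg r {{nonNegative 0≤r}}

  *-monoʳ : ∀ {p q r} → 0ℚ ≤ r → p ≤ q → p * r ≤ q * r
  *-monoʳ {r = r} 0≤r = *-monoʳ-≤-nonNeg r {{nonNegative 0≤r}}

  *-mono : ∀ {p q r s} → 0ℚ ≤ p → 0ℚ ≤ s → p ≤ q → r ≤ s → p * r ≤ q * s
  *-mono 0≤p 0≤s p≤q r≤s = ≤-trans (*-monoˡ 0≤p r≤s) (*-monoʳ 0≤s p≤q)

  0≤* : ∀ {p q} → 0ℚ ≤ p → 0ℚ ≤ q → 0ℚ ≤ p * q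
  0≤* {p} {q} 0≤p 0≤q = subst (_≤ p * q) (*-zeroʳ p) (*-monoˡ 0≤p 0≤q)

  0≤+ : ∀ {p q} → 0ℚ ≤ p → 0ℚ ≤ q → 0ℚ ≤ p + q
  0≤+ = +-mono-≤

  0<* : ∀ {p q} → 0ℚ < p → 0ℚ < q → 0ℚ < p * q
  0<* {p} {q} 0<p 0<q =
    subst (_< p * q) (*-zeroʳ p) (*-monoʳ-<-pos p {{positive 0<p}} 0<q)

  p≤p+q : ∀ {p q} → 0ℚ ≤ q → p ≤ p + q
  p≤p+q {p} {q} 0≤q = subst (_≤ p + q) (+-identityʳ p) (+-monoʳ-≤ p 0≤q)

  p≤∣p∣ : ∀ p → p ≤ ∣ p ∣
  p≤∣p∣ p with ≤-total 0ℚ p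
  ... | inj₁ 0≤p = ≤-reflexive (sym (0≤p⇒∣p∣≡p 0≤p))
  ... | inj₂ p≤0 = ≤-trans p≤0 (0≤∣p∣ p)

  ∣∣-≤ : ∀ {p q} → p ≤ q → - p ≤ q → ∣ p ∣ ≤ q
  ∣∣-≤ {p} {q} p≤q -p≤q with ∣p∣≡p∨∣p∣≡-p p
  ... | inj₁ eq = subst (_≤ q) (sym eq) p≤q
  ... | inj₂ eq = subst (_≤ q) (sym eq) -p≤q

  neg-sub : ∀ p q → - (p - q) ≡ q - p
  neg-sub = solve 2 (λ p q → :- (p :- q) := q :- p) refl

  ∣-∣-sym : ∀ p q → ∣ p - q ∣ ≡ ∣ q - p ∣
  ∣-∣-sym p q = trans (sym (∣-p∣≡∣p∣ (p - q))) (cong ∣_∣ (neg-sub p q))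

  ≤+⇒-≤ : ∀ {p q r} → p ≤ q + r → p - q ≤ r
  ≤+⇒-≤ {p} {q} {r} p≤q+r =
    subst (p - q ≤_) (solve 2 (λ q r → (q :+ r) :- q := r) refl q r)
      (+-monoˡ-≤ (- q) p≤q+r)

  ∣-∣-≤ : ∀ p q {r} → p ≤ q + r → q ≤ p + r → ∣ p - q ∣ ≤ r
  ∣-∣-≤ p q {r} p≤ q≤ =
    ∣∣-≤ (≤+⇒-≤ p≤) (subst (_≤ r) (sym (neg-sub p q)) (≤+⇒-≤ q≤))

  ≤+∣-∣ : ∀ p q → p ≤ q + ∣ p - q ∣
  ≤+∣-∣ p q = subst (_≤ q + ∣ p - q ∣)
    (solve 2 (λ p q → q :+ (p :- q) := p) refl p q) (+-monoʳ-≤ q (p≤∣p∣ (p - q)))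

  ∣-∣-≤⇒≤+ : ∀ p q {r} → ∣ p - q ∣ ≤ r → p ≤ q + r
  ∣-∣-≤⇒≤+ p q h = ≤-trans (≤+∣-∣ p q) (+-monoʳ-≤ q h)

  ∣-∣-triangle : ∀ p q r → ∣ p - r ∣ ≤ ∣ p - q ∣ + ∣ q - r ∣
  ∣-∣-triangle p q r = subst (λ s → ∣ s ∣ ≤ ∣ p - q ∣ + ∣ q - r ∣)
    (solve 3 (λ p q r → (p :- q) :+ (q :- r) := p :- r) refl p q r)
    (∣p+q∣≤∣p∣+∣q∣ (p - q) (q - r))

  +-close : ∀ p q p′ q′ → ∣ (p + q) - (p′ + q′) ∣ ≤ ∣ p - p′ ∣ + ∣ q - q′ ∣
  +-close p q p′ q′ = subst (λ s → ∣ s ∣ ≤ ∣ p - p′ ∣ + ∣ q - q′ ∣)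
    (solve 4 (λ p q p′ q′ → (p :- p′) :+ (q :- q′) := (p :+ q) :- (p′ :+ q′))
      refl p q p′ q′)
    (∣p+q∣≤∣p∣+∣q∣ (p - p′) (q - q′))

  *-close : ∀ p q p′ q′ →
            ∣ p * q - p′ * q′ ∣ ≤ ∣ p ∣ * ∣ q - q′ ∣ + ∣ p - p′ ∣ * ∣ q′ ∣
  *-close p q p′ q′ = begin
    ∣ p * q - p′ * q′ ∣
      ≡⟨ cong ∣_∣ (solve 4 (λ p q p′ q′ →
           p :* q :- p′ :* q′ := p :* (q :- q′) :+ (p :- p′) :* q′) refl p q p′ q′) ⟩
    ∣ p * (q - q′) + (p - p′) * q′ ∣
      ≤⟨ ∣p+q∣≤∣p∣+∣q∣ (p * (q - q′)) ((p - p′) * q′) ⟩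
    ∣ p * (q - q′) ∣ + ∣ (p - p′) * q′ ∣
      ≡⟨ cong₂ _+_ (∣p*q∣≡∣p∣*∣q∣ p (q - q′)) (∣p*q∣≡∣p∣*∣q∣ (p - p′) q′) ⟩
    ∣ p ∣ * ∣ q - q′ ∣ + ∣ p - p′ ∣ * ∣ q′ ∣ ∎

  ⊔-≤+ : ∀ p q p′ q′ {r} → p ≤ p′ + r → q ≤ q′ + r → p ⊔ q ≤ (p′ ⊔ q′) + r
  ⊔-≤+ p q p′ q′ {r} p≤ q≤ = ⊔-lub
    (≤-trans p≤ (+-monoˡ-≤ r (p≤p⊔q p′ q′)))
    (≤-trans q≤ (+-monoˡ-≤ r (p≤q⊔p p′ q′)))

  shrink : ∀ C ε → 0ℚ ≤ C → 0ℚ < ε → ∃[ η ] 0ℚ < η × C * η ≤ ε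
  shrink C ε 0≤C 0<ε = ε * inv , 0<* 0<ε 0<inv , (begin
    C * (ε * inv)     ≤⟨ *-monoʳ (<⇒≤ (0<* 0<ε 0<inv)) (p≤p+q {C} 0≤1) ⟩
    D * (ε * inv)     ≡⟨ solve 3 (λ D ε i → D :* (ε :* i) := (D :* i) :* ε) refl D ε inv ⟩
    (D * inv) * ε     ≡⟨ cong (_* ε) (*-inverseʳ D) ⟩
    1ℚ * ε            ≡⟨ *-identityˡ ε ⟩
    ε                 ∎)
    where
    D : ℚ
    D = C + 1ℚ
    0<D : 0ℚ < D
    0<D = +-mono-≤-< {0ℚ} {C} {0ℚ} {1ℚ} 0≤C 0<1
    instance
      D-pos : Positive D
      D-pos = positive 0<D
      D-nonZero : NonZero D
      D-nonZero = pos⇒nonZero D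
    inv : ℚ
    inv = 1/ D
    0<inv : 0ℚ < inv
    0<inv = positive⁻¹ inv {{1/pos⇒pos D}}

  recip : ℚ → ℚ
  recip q with q ≟ 0ℚ
  ... | yes _   = 0ℚ
  ... | no q≢0 = (1/ q) {{≢-nonZero q≢0}}

  recip-inverse : ∀ {q} → 0ℚ < q → q * recip q ≡ 1ℚ
  recip-inverse {q} 0<q with q ≟ 0ℚ
  ... | yes q≡0 = contradiction (sym q≡0) (<⇒≢ 0<q)
  ... | no q≢0  = *-inverseʳ q {{≢-nonZero q≢0}}

  recip-pos : ∀ {q} → 0ℚ < q → 0ℚ ≤ recip q
  recip-pos {q} 0<q with q ≟ 0ℚ
  ... | yes _  = ≤-refl
  ... | no q≢0 = <⇒≤ (positive⁻¹ _ {{1/pos⇒pos q {{positive 0<q}}}})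

  recip-anti : ∀ {p q} → 0ℚ < p → p ≤ q → recip q ≤ recip p
  recip-anti {p} {q} 0<p p≤q = begin
    recip q                  ≡⟨ *-identityˡ (recip q) ⟨
    1ℚ * recip q             ≡⟨ cong (_* recip q) (recip-inverse 0<p) ⟨
    (p * recip p) * recip q  ≤⟨ *-monoʳ (recip-pos 0<q) (*-monoʳ (recip-pos 0<p) p≤q) ⟩
    (q * recip p) * recip q  ≡⟨ solve 3 (λ q a b → (q :* a) :* b := (q :* b) :* a)
                                  refl q (recip p) (recip q) ⟩
    (q * recip q) * recip p  ≡⟨ cong (_* recip p) (recip-inverse 0<q) ⟩
    1ℚ * recip p             ≡⟨ *-identityˡ (recip p) ⟩
    recip p                  ∎
    where
    0<q : 0ℚ < q
    0<q = <-≤-trans 0<p p≤q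

  recip-close : ∀ {b p q} → 0ℚ < b → b ≤ p → b ≤ q →
                ∣ recip p - recip q ∣ ≤ (recip b * recip b) * ∣ p - q ∣
  recip-close {b} {p} {q} 0<b b≤p b≤q = begin
    ∣ rp - rq ∣
      ≡⟨ cong ∣_∣ (cong₂ _-_ (sym (*-identityˡ rp)) (sym (*-identityˡ rq))) ⟩
    ∣ 1ℚ * rp - 1ℚ * rq ∣
      ≡⟨ cong ∣_∣ (cong₂ _-_ (cong (_* rp) (sym (recip-inverse 0<q)))
                             (cong (_* rq) (sym (recip-inverse 0<p)))) ⟩
    ∣ (q * rq) * rp - (p * rp) * rq ∣
      ≡⟨ cong ∣_∣ (solve 4 (λ p q a b →
           (q :* b) :* a :- (p :* a) :* b := (a :* b) :* (q :- p)) refl p q rp rq) ⟩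
    ∣ (rp * rq) * (q - p) ∣
      ≡⟨ ∣p*q∣≡∣p∣*∣q∣ (rp * rq) (q - p) ⟩
    ∣ rp * rq ∣ * ∣ q - p ∣
      ≡⟨ cong₂ _*_ (0≤p⇒∣p∣≡p (0≤* 0≤rp 0≤rq)) (∣-∣-sym q p) ⟩
    (rp * rq) * ∣ p - q ∣
      ≤⟨ *-monoʳ (0≤∣p∣ (p - q))
           (*-mono 0≤rp (recip-pos 0<b) (recip-anti 0<b b≤p) (recip-anti 0<b b≤q)) ⟩
    (recip b * recip b) * ∣ p - q ∣ ∎
    where
    rp rq : ℚ
    rp = recip p
    rq = recip q
    0<p : 0ℚ < p
    0<p = <-≤-trans 0<b b≤p
    0<q : 0ℚ < q
    0<q = <-≤-trans 0<b b≤q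
    0≤rp : 0ℚ ≤ rp
    0≤rp = recip-pos 0<p
    0≤rq : 0ℚ ≤ rq
    0≤rq = recip-pos 0<q

  fromℕ : ℕ → ℚ
  fromℕ zero    = 0ℚ
  fromℕ (suc n) = 1ℚ + fromℕ n

  0≤fromℕ : ∀ n → 0ℚ ≤ fromℕ n
  0≤fromℕ zero    = ≤-refl
  0≤fromℕ (suc n) = 0≤+ 0≤1 (0≤fromℕ n)

  0<fromℕ-suc : ∀ n → 0ℚ < fromℕ (suc n)
  0<fromℕ-suc n = +-mono-<-≤ {0ℚ} {1ℚ} {0ℚ} {fromℕ n} 0<1 (0≤fromℕ n)

  fromℕ-mono : ∀ {m n} → m ℕ.≤ n → fromℕ m ≤ fromℕ n
  fromℕ-mono {n = n} ℕ.z≤n = 0≤fromℕ n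
  fromℕ-mono (ℕ.s≤s m≤n)   = +-monoʳ-≤ 1ℚ (fromℕ-mono m≤n)

  fromℕ-+ : ∀ m n → fromℕ (m ℕ.+ n) ≡ fromℕ m + fromℕ n
  fromℕ-+ zero    n = sym (+-identityˡ (fromℕ n))
  fromℕ-+ (suc m) n =
    trans (cong (λ q → 1ℚ + q) (fromℕ-+ m n)) (sym (+-assoc 1ℚ (fromℕ m) (fromℕ n)))

  fromℕ-* : ∀ m n → fromℕ (m ℕ.* n) ≡ fromℕ m * fromℕ n
  fromℕ-* zero    n = sym (*-zeroˡ (fromℕ n))
  fromℕ-* (suc m) n = begin-equality
    fromℕ (n ℕ.+ m ℕ.* n)             ≡⟨ fromℕ-+ n (m ℕ.* n) ⟩
    fromℕ n + fromℕ (m ℕ.* n)         ≡⟨ cong (fromℕ n +_) (fromℕ-* m n) ⟩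
    fromℕ n + fromℕ m * fromℕ n       ≡⟨ solve 2 (λ m n → n :+ m :* n := (con 1ℚ :+ m) :* n)
                                           refl (fromℕ m) (fromℕ n) ⟩
    (1ℚ + fromℕ m) * fromℕ n          ∎

  fromℕ-mkℚ : ∀ n → fromℕ n ≡ mkℚ (ℤ.+ n) 0 (Coprime.sym (Coprime.1-coprimeTo n))
  fromℕ-mkℚ zero    = refl
  fromℕ-mkℚ (suc n) = trans (cong (λ q → 1ℚ + q) (fromℕ-mkℚ n))
    (trans (cong (Rat._/ 1) (cong (λ z → (ℤ.+ 1) ℤ.+ z) (ℤₚ.*-identityʳ (ℤ.+ n))))
           (↥p/↧p≡p (mkℚ (ℤ.+ suc n) 0 (Coprime.sym (Coprime.1-coprimeTo (suc n))))))

  ceilℕ : ℚ → ℕ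
  ceilℕ q = ℤ.∣ ↥ q ∣

  ≤-ceilℕ : ∀ q → q ≤ fromℕ (ceilℕ q)
  ≤-ceilℕ q@(mkℚ n d _) = subst (q ≤_) (sym (fromℕ-mkℚ ℤ.∣ n ∣)) (*≤* (go n))
    where
    go : ∀ n → n ℤ.* (ℤ.+ 1) ℤ.≤ (ℤ.+ ℤ.∣ n ∣) ℤ.* (ℤ.+ suc d)
    go (ℤ.+ m)        = subst₂ ℤ._≤_ (ℤₚ.pos-* m 1) (ℤₚ.pos-* m (suc d))
                        (ℤ.+≤+ (ℕₚ.*-monoʳ-≤ m (ℕ.s≤s ℕ.z≤n)))
    go (ℤ.-[1+ m ]) = ℤ.-≤+

  archimedean : ∀ q {ε} → 0ℚ < ε → ∃[ n ] q ≤ fromℕ n * ε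
  archimedean q {ε} 0<ε = ceilℕ (q * recip ε) , (begin
    q                    ≡⟨ *-identityʳ q ⟨
    q * 1ℚ               ≡⟨ cong (q *_) (recip-inverse 0<ε) ⟨
    q * (ε * recip ε)    ≡⟨ solve 3 (λ q e r → q :* (e :* r) := (q :* r) :* e)
                              refl q ε (recip ε) ⟩
    (q * recip ε) * ε    ≤⟨ *-monoʳ (<⇒≤ 0<ε) (≤-ceilℕ (q * recip ε)) ⟩
    fromℕ (ceilℕ (q * recip ε)) * ε ∎)

  expTerm : ℚ → ℕ → ℚ
  expTerm q k = (q ^ k) * recip (fromℕ (k !))

  -- expSum q n = Σ_{k<n} q^k / k!
  expSum : ℚ → ℕ → ℚ
  expSum q zero    = 0ℚ
  expSum q (suc n) = expSum q n + expTerm q n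

  0<fromℕ-! : ∀ k → 0ℚ < fromℕ (k !)
  0<fromℕ-! k with k ! | ℕₚ.1≤n! k
  ... | suc m | _ = 0<fromℕ-suc m

  expTerm-suc : ∀ q k → fromℕ (suc k) * expTerm q (suc k) ≡ q * expTerm q k
  expTerm-suc q k = begin-equality
    a * ((q * q ^ k) * recip (fromℕ (suc k ℕ.* k !)))
      ≡⟨ cong (λ z → a * ((q * q ^ k) * recip z)) (fromℕ-* (suc k) (k !)) ⟩
    a * ((q * q ^ k) * r)
      ≡⟨ *-identityʳ _ ⟨
    a * ((q * q ^ k) * r) * 1ℚ
      ≡⟨ cong (λ z → a * ((q * q ^ k) * r) * z) (recip-inverse (0<fromℕ-! k)) ⟨
    a * ((q * q ^ k) * r) * (b * recip b)
      ≡⟨ solve 6 (λ a b q p r s →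
           a :* ((q :* p) :* r) :* (b :* s) := ((a :* b) :* r) :* (q :* (p :* s)))
           refl a b q (q ^ k) r (recip b) ⟩
    ((a * b) * r) * (q * (q ^ k * recip b))
      ≡⟨ cong (_* (q * (q ^ k * recip b)))
           (recip-inverse (0<* (0<fromℕ-suc k) (0<fromℕ-! k))) ⟩
    1ℚ * (q * (q ^ k * recip b))
      ≡⟨ *-identityˡ _ ⟩
    q * (q ^ k * recip b) ∎
    where
    a b r : ℚ
    a = fromℕ (suc k)
    b = fromℕ (k !)
    r = recip (a * b)

  cancel-suc : ∀ k {p q} → fromℕ (suc k) * p ≤ fromℕ (suc k) * q → p ≤ q
  cancel-suc k = *-cancelˡ-≤-pos (fromℕ (suc k)) {{positive (0<fromℕ-suc k)}}

  suc*∣∣ : ∀ k p → fromℕ (suc k) * ∣ p ∣ ≡ ∣ fromℕ (suc k) * p ∣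
  suc*∣∣ k p = trans (cong (_* ∣ p ∣) (sym (0≤p⇒∣p∣≡p (0≤fromℕ (suc k)))))
                     (sym (∣p*q∣≡∣p∣*∣q∣ (fromℕ (suc k)) p))

  module ExpBounds {B : ℚ} (0≤B : 0ℚ ≤ B) where

    T Σₜ : ℕ → ℚ
    T  = expTerm B
    Σₜ = expSum B

    ∣expTerm∣≤ : ∀ {a} → ∣ a ∣ ≤ B → ∀ k → ∣ expTerm a k ∣ ≤ T k
    ∣expTerm∣≤ a≤ zero    = ≤-refl
    ∣expTerm∣≤ {a} a≤ (suc k) = cancel-suc k (begin
      fromℕ (suc k) * ∣ expTerm a (suc k) ∣   ≡⟨ suc*∣∣ k (expTerm a (suc k)) ⟩
      ∣ fromℕ (suc k) * expTerm a (suc k) ∣   ≡⟨ cong ∣_∣ (expTerm-suc a k) ⟩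
      ∣ a * expTerm a k ∣                     ≡⟨ ∣p*q∣≡∣p∣*∣q∣ a (expTerm a k) ⟩
      ∣ a ∣ * ∣ expTerm a k ∣                 ≤⟨ *-mono (0≤∣p∣ a)
                                                  (≤-trans (0≤∣p∣ (expTerm a k)) ih) a≤ ih ⟩
      B * T k                                 ≡⟨ expTerm-suc B k ⟨
      fromℕ (suc k) * T (suc k)               ∎)
      where
      ih : ∣ expTerm a k ∣ ≤ T k
      ih = ∣expTerm∣≤ a≤ k

    0≤T : ∀ k → 0ℚ ≤ T k
    0≤T k = ≤-trans (0≤∣p∣ (T k)) (∣expTerm∣≤ (≤-reflexive (0≤p⇒∣p∣≡p 0≤B)) k)

    0≤Σₜ : ∀ n → 0ℚ ≤ Σₜ n
    0≤Σₜ zero    = ≤-refl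
    0≤Σₜ (suc n) = 0≤+ (0≤Σₜ n) (0≤T n)

    T′ : ℕ → ℚ
    T′ zero    = 0ℚ
    T′ (suc k) = T k

    B*T′ : ∀ k → B * T′ k ≡ fromℕ k * T k
    B*T′ zero    = trans (*-zeroʳ B) (sym (*-zeroˡ (T 0)))
    B*T′ (suc k) = sym (expTerm-suc B k)

    0≤T′ : ∀ k → 0ℚ ≤ T′ k
    0≤T′ zero    = ≤-refl
    0≤T′ (suc k) = 0≤T k

    module _ {a b : ℚ} (a≤ : ∣ a ∣ ≤ B) (b≤ : ∣ b ∣ ≤ B) where

      d : ℚ
      d = ∣ a - b ∣

      0≤d : 0ℚ ≤ d
      0≤d = 0≤∣p∣ (a - b)

      expTerm-lipschitz : ∀ k → ∣ expTerm a k - expTerm b k ∣ ≤ d * T′ k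
      expTerm-lipschitz zero    = ≤-reflexive (sym (*-zeroʳ d))
      expTerm-lipschitz (suc k) = cancel-suc k (begin
        n * ∣ expTerm a (suc k) - expTerm b (suc k) ∣
          ≡⟨ suc*∣∣ k (expTerm a (suc k) - expTerm b (suc k)) ⟩
        ∣ n * (expTerm a (suc k) - expTerm b (suc k)) ∣
          ≡⟨ cong ∣_∣ (solve 3 (λ n x y → n :* (x :- y) := n :* x :- n :* y)
               refl n (expTerm a (suc k)) (expTerm b (suc k))) ⟩
        ∣ n * expTerm a (suc k) - n * expTerm b (suc k) ∣
          ≡⟨ cong ∣_∣ (cong₂ _-_ (expTerm-suc a k) (expTerm-suc b k)) ⟩
        ∣ a * expTerm a k - b * expTerm b k ∣
          ≤⟨ *-close a (expTerm a k) b (expTerm b k) ⟩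
        ∣ a ∣ * ∣ expTerm a k - expTerm b k ∣ + d * ∣ expTerm b k ∣
          ≤⟨ +-mono-≤ (*-mono (0≤∣p∣ a) (0≤* 0≤d (0≤T′ k)) a≤ (expTerm-lipschitz k))
                      (*-monoˡ 0≤d (∣expTerm∣≤ b≤ k)) ⟩
        B * (d * T′ k) + d * T k
          ≡⟨ solve 4 (λ B d s t → B :* (d :* s) :+ d :* t := d :* (B :* s) :+ d :* t)
               refl B d (T′ k) (T k) ⟩
        d * (B * T′ k) + d * T k
          ≡⟨ cong (λ z → d * z + d * T k) (B*T′ k) ⟩
        d * (fromℕ k * T k) + d * T k
          ≡⟨ solve 3 (λ d m t → d :* (m :* t) :+ d :* t := (con 1ℚ :+ m) :* (d :* t))
               refl d (fromℕ k) (T k) ⟩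
        n * (d * T k) ∎)
        where
        n : ℚ
        n = fromℕ (suc k)

      expSum-lipschitz : ∀ n → ∣ expSum a n - expSum b n ∣ ≤ d * Σₜ (ℕ.pred n)
      expSum-lipschitz zero    = ≤-reflexive (sym (*-zeroʳ d))
      expSum-lipschitz (suc n) = begin
        ∣ (expSum a n + expTerm a n) - (expSum b n + expTerm b n) ∣
          ≤⟨ +-close (expSum a n) (expTerm a n) (expSum b n) (expTerm b n) ⟩
        ∣ expSum a n - expSum b n ∣ + ∣ expTerm a n - expTerm b n ∣
          ≤⟨ +-mono-≤ (expSum-lipschitz n) (expTerm-lipschitz n) ⟩
        d * Σₜ (ℕ.pred n) + d * T′ n
          ≡⟨ *-distribˡ-+ d (Σₜ (ℕ.pred n)) (T′ n) ⟨
        d * (Σₜ (ℕ.pred n) + T′ n)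
          ≡⟨ cong (d *_) (Σₜ-pred n) ⟩
        d * Σₜ n ∎
        where
        Σₜ-pred : ∀ n → Σₜ (ℕ.pred n) + T′ n ≡ Σₜ n
        Σₜ-pred zero    = refl
        Σₜ-pred (suc n) = refl

    expSum-tail : ∀ {b} → ∣ b ∣ ≤ B → ∀ {m n} → m ℕ.≤′ n →
                  ∣ expSum b m - expSum b n ∣ ≤ Σₜ n - Σₜ m
    expSum-tail {b} b≤ {m} ℕ.≤′-refl = ≤-reflexive
      (trans (cong ∣_∣ (+-inverseʳ (expSum b m))) (sym (+-inverseʳ (Σₜ m))))
    expSum-tail {b} b≤ {m} (ℕ.≤′-step {n} m≤n) = begin
      ∣ s - (expSum b n + expTerm b n) ∣
        ≡⟨ cong ∣_∣ (solve 3 (λ s u t → s :- (u :+ t) := (s :- u) :- t)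
             refl s (expSum b n) (expTerm b n)) ⟩
      ∣ (s - expSum b n) - expTerm b n ∣
        ≤⟨ ∣p-q∣≤∣p∣+∣q∣ (s - expSum b n) (expTerm b n) ⟩
      ∣ s - expSum b n ∣ + ∣ expTerm b n ∣
        ≤⟨ +-mono-≤ (expSum-tail b≤ m≤n) (∣expTerm∣≤ b≤ n) ⟩
      (Σₜ n - Σₜ m) + T n
        ≡⟨ solve 3 (λ u v t → (u :- v) :+ t := (u :+ t) :- v) refl (Σₜ n) (Σₜ m) (T n) ⟩
      (Σₜ n + T n) - Σₜ m ∎
      where
      s : ℚ
      s = expSum b m

    K : ℕ
    K = ceilℕ (B + B)

    -- From index K on, each term is at most half the previous one, so D decreases.
    D : ℕ → ℚ
    D n = Σₜ n + (T n + T n)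

    C : ℚ
    C = D K

    T-halves : ∀ {k} → K ℕ.≤ k → T (suc k) + T (suc k) ≤ T k
    T-halves {k} K≤k = cancel-suc k (begin
      n * (T (suc k) + T (suc k))      ≡⟨ *-distribˡ-+ n (T (suc k)) (T (suc k)) ⟩
      n * T (suc k) + n * T (suc k)    ≡⟨ cong₂ _+_ (expTerm-suc B k) (expTerm-suc B k) ⟩
      B * T k + B * T k                ≡⟨ *-distribʳ-+ (T k) B B ⟨
      (B + B) * T k                    ≤⟨ *-monoʳ (0≤T k) (≤-trans (≤-ceilℕ (B + B))
                                            (fromℕ-mono (ℕₚ.m≤n⇒m≤1+n K≤k))) ⟩
      n * T k                          ∎)
      where
      n : ℚ
      n = fromℕ (suc k)

    D-anti : ∀ {m n} → K ℕ.≤ m → m ℕ.≤′ n → D n ≤ D m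
    D-anti K≤m ℕ.≤′-refl = ≤-refl
    D-anti {m} K≤m (ℕ.≤′-step {n} m≤n) = begin
      (Σₜ n + T n) + (T (suc n) + T (suc n))
        ≤⟨ +-monoʳ-≤ (Σₜ n + T n) (T-halves (ℕₚ.≤-trans K≤m (ℕₚ.≤′⇒≤ m≤n))) ⟩
      (Σₜ n + T n) + T n   ≡⟨ +-assoc (Σₜ n) (T n) (T n) ⟩
      D n                  ≤⟨ D-anti K≤m m≤n ⟩
      D m                  ∎

    0≤C : 0ℚ ≤ C
    0≤C = 0≤+ (0≤Σₜ K) (0≤+ (0≤T K) (0≤T K))

    D≤C : ∀ {n} → K ℕ.≤ n → D n ≤ C
    D≤C K≤n = D-anti ℕₚ.≤-refl (ℕₚ.≤⇒≤′ K≤n)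

    Σₜ≤D : ∀ n → Σₜ n ≤ D n
    Σₜ≤D n = p≤p+q (0≤+ (0≤T n) (0≤T n))

    Σₜ-tail : ∀ {m n} → K ℕ.≤ m → m ℕ.≤ n → Σₜ n - Σₜ m ≤ T m + T m
    Σₜ-tail {m} {n} K≤m m≤n =
      ≤+⇒-≤ (≤-trans (Σₜ≤D n) (D-anti K≤m (ℕₚ.≤⇒≤′ m≤n)))

    T≤C : ∀ {k} → K ℕ.≤ k → T k ≤ C
    T≤C {k} K≤k = begin
      T k             ≤⟨ p≤p+q (0≤T k) ⟩
      T k + T k       ≡⟨ +-identityˡ (T k + T k) ⟨
      0ℚ + (T k + T k) ≤⟨ +-monoˡ-≤ (T k + T k) (0≤Σₜ k) ⟩
      D k             ≤⟨ D≤C K≤k ⟩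
      C               ∎

    T-small : ∀ {η} → 0ℚ < η → ∃[ N ] (∀ {m} → N ℕ.≤ m → suc K ℕ.≤ m × T m ≤ η)
    T-small {η} 0<η = suc (K ℕ.⊔ M) , small
      where
      M : ℕ
      M = proj₁ (archimedean (B * C) 0<η)
      BC≤ : B * C ≤ fromℕ M * η
      BC≤ = proj₂ (archimedean (B * C) 0<η)
      small : ∀ {m} → suc (K ℕ.⊔ M) ℕ.≤ m → suc K ℕ.≤ m × T m ≤ η
      small {suc k} (ℕ.s≤s h) = ℕ.s≤s K≤k , cancel-suc k (begin
        fromℕ (suc k) * T (suc k)  ≡⟨ expTerm-suc B k ⟩
        B * T k                    ≤⟨ *-monoˡ 0≤B (T≤C K≤k) ⟩
        B * C                      ≤⟨ BC≤ ⟩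
        fromℕ M * η                ≤⟨ *-monoʳ (<⇒≤ 0<η) (fromℕ-mono (ℕₚ.m≤n⇒m≤1+n M≤k)) ⟩
        fromℕ (suc k) * η          ∎)
        where
        K≤k : K ℕ.≤ k
        K≤k = ℕₚ.≤-trans (ℕₚ.m≤m⊔n K M) h
        M≤k : M ℕ.≤ k
        M≤k = ℕₚ.≤-trans (ℕₚ.m≤n⊔m K M) h

    expSum-close : ∀ {a b m n η} → ∣ a ∣ ≤ B → ∣ b ∣ ≤ B → suc K ℕ.≤ m → m ℕ.≤ n →
                   ∣ a - b ∣ ≤ η → T m ≤ η →
                   ∣ expSum a m - expSum b n ∣ ≤ (C + (1ℚ + 1ℚ)) * η
    expSum-close {a} {b} {suc m} {n} {η} a≤ b≤ (ℕ.s≤s K≤m) m≤n ab≤ Tm≤ = begin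
      ∣ expSum a (suc m) - expSum b n ∣
        ≤⟨ ∣-∣-triangle (expSum a (suc m)) (expSum b (suc m)) (expSum b n) ⟩
      ∣ expSum a (suc m) - expSum b (suc m) ∣ + ∣ expSum b (suc m) - expSum b n ∣
        ≤⟨ +-mono-≤
             (≤-trans (expSum-lipschitz a≤ b≤ (suc m))
               (*-mono (0≤∣p∣ (a - b)) 0≤C ab≤ (≤-trans (Σₜ≤D m) (D≤C K≤m))))
             (≤-trans (expSum-tail b≤ (ℕₚ.≤⇒≤′ m≤n))
               (≤-trans (Σₜ-tail (ℕₚ.m≤n⇒m≤1+n K≤m) m≤n) (+-mono-≤ Tm≤ Tm≤))) ⟩
      η * C + (η + η)
        ≡⟨ solve 2 (λ η c → η :* c :+ (η :+ η) := (c :+ (con 1ℚ :+ con 1ℚ)) :* η)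
             refl η C ⟩
      (C + (1ℚ + 1ℚ)) * η ∎

open RationalLemmas using (recip; expSum)

-- Reals are Cauchy sequences of rationals; _≈_ is their equality, since
-- propositional equality distinguishes sequences with the same limit.

IsCauchy : (ℕ → ℚ) → Set
IsCauchy s = ∀ {ε} → 0ℚ Rat.< ε →
  ∃[ N ] (∀ {m n} → N ℕ.≤ m → N ℕ.≤ n → Rat.∣ s m Rat.- s n ∣ Rat.≤ ε)

record ℝ : Set where
  constructor mkℝ
  field
    seq    : ℕ → ℚ
    cauchy : IsCauchy seq

open ℝ public

infix 4 _≤_ _<_ _≈_

_≤_ : ℝ → ℝ → Set
x ≤ y = ∀ {ε} → 0ℚ Rat.< ε →
  ∃[ N ] (∀ {n} → N ℕ.≤ n → seq x n Rat.≤ seq y n Rat.+ ε)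

_<_ : ℝ → ℝ → Set
x < y = ∃[ ε ] 0ℚ Rat.< ε ×
  ∃[ N ] (∀ {n} → N ℕ.≤ n → seq x n Rat.+ ε Rat.≤ seq y n)

_≈_ : ℝ → ℝ → Set
x ≈ y = x ≤ y × y ≤ x

module CauchyLemmas where
  open Rat using (∣_∣) renaming
    (_+_ to _+ᵠ_; _*_ to _*ᵠ_; _-_ to _-ᵠ_; -_ to -ᵠ_; _⊔_ to _⊔ᵠ_; _≤_ to _≤ᵠ_; _<_ to _<ᵠ_)
  open RationalLemmas hiding (recip; expSum)
  open ℚₚ using (≤-trans; ≤-reflexive; +-mono-≤; ∣p+q∣≤∣p∣+∣q∣; 0≤∣p∣; module ≤-Reasoning)
  open +-*-Solver
  open ≤-Reasoning

  -- The Cauchy condition is symmetric in the two indices.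
  ordered⇒cauchy : ∀ s → (∀ {ε} → 0ℚ <ᵠ ε →
    ∃[ N ] (∀ {m n} → N ℕ.≤ m → m ℕ.≤ n → ∣ s m -ᵠ s n ∣ ≤ᵠ ε)) → IsCauchy s
  ordered⇒cauchy s h 0<ε with h 0<ε
  ... | N , close = N , λ {m} {n} N≤m N≤n →
    [ (λ m≤n → close N≤m m≤n)
    , (λ n≤m → subst (_≤ᵠ _) (∣-∣-sym (s n) (s m)) (close N≤n n≤m)) ]′ (ℕₚ.≤-total m n)

  bounded : ∀ x → ∃[ B ] 0ℚ ≤ᵠ B × ∃[ N ] (∀ {n} → N ℕ.≤ n → ∣ seq x n ∣ ≤ᵠ B)
  bounded x =
    let N , close = cauchy x {1ℚ} 0<1 in
    ∣ seq x N ∣ +ᵠ 1ℚ , 0≤+ (0≤∣p∣ (seq x N)) 0≤1 , N , λ {n} N≤n → begin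
      ∣ seq x n ∣
        ≡⟨ cong ∣_∣ (solve 2 (λ p q → p := q :+ (p :- q)) refl (seq x n) (seq x N)) ⟩
      ∣ seq x N +ᵠ (seq x n -ᵠ seq x N) ∣
        ≤⟨ ∣p+q∣≤∣p∣+∣q∣ (seq x N) (seq x n -ᵠ seq x N) ⟩
      ∣ seq x N ∣ +ᵠ ∣ seq x n -ᵠ seq x N ∣
        ≤⟨ ℚₚ.+-monoʳ-≤ ∣ seq x N ∣ (close N≤n ℕₚ.≤-refl) ⟩
      ∣ seq x N ∣ +ᵠ 1ℚ ∎

  both : ∀ {N N′ n} → N ℕ.⊔ N′ ℕ.≤ n → N ℕ.≤ n × N′ ℕ.≤ n
  both {N} {N′} h = ℕₚ.m⊔n≤o⇒m≤o N N′ h , ℕₚ.m⊔n≤o⇒n≤o N N′ h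

  const-cauchy : ∀ q → IsCauchy (λ _ → q)
  const-cauchy q 0<ε = 0 , λ _ _ →
    subst (_≤ᵠ _) (sym (cong ∣_∣ (ℚₚ.+-inverseʳ q))) (ℚₚ.<⇒≤ 0<ε)

  neg-cauchy : ∀ x → IsCauchy (λ n → -ᵠ seq x n)
  neg-cauchy x 0<ε with cauchy x 0<ε
  ... | N , close = N , λ {m} {n} N≤m N≤n → subst (_≤ᵠ _)
    (cong ∣_∣ (solve 2 (λ p q → p :- q := :- q :- :- p) refl (seq x n) (seq x m)))
    (close N≤n N≤m)

  +-cauchy : ∀ x y → IsCauchy (λ n → seq x n +ᵠ seq y n)
  +-cauchy x y {ε} 0<ε =
    let η , 0<η , 2η≤ε = shrink (1ℚ +ᵠ 1ℚ) ε (0≤+ 0≤1 0≤1) 0<ε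
        N  , x-close   = cauchy x 0<η
        N′ , y-close   = cauchy y 0<η
    in N ℕ.⊔ N′ , λ {m} {n} hm hn → begin
    ∣ (seq x m +ᵠ seq y m) -ᵠ (seq x n +ᵠ seq y n) ∣
      ≤⟨ +-close (seq x m) (seq y m) (seq x n) (seq y n) ⟩
    ∣ seq x m -ᵠ seq x n ∣ +ᵠ ∣ seq y m -ᵠ seq y n ∣
      ≤⟨ +-mono-≤ (x-close (proj₁ (both hm)) (proj₁ (both hn)))
                  (y-close (proj₂ (both {N} hm)) (proj₂ (both {N} hn))) ⟩
    η +ᵠ η
      ≡⟨ solve 1 (λ η → η :+ η := (con 1ℚ :+ con 1ℚ) :* η) refl η ⟩
    (1ℚ +ᵠ 1ℚ) *ᵠ η
      ≤⟨ 2η≤ε ⟩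
    ε ∎

  *-cauchy : ∀ x y → IsCauchy (λ n → seq x n *ᵠ seq y n)
  *-cauchy x y {ε} 0<ε =
    let A , 0≤A , Nx , x≤A = bounded x
        B , 0≤B , Ny , y≤B = bounded y
        η , 0<η , η-small  = shrink (A +ᵠ B) ε (0≤+ 0≤A 0≤B) 0<ε
        N  , x-close       = cauchy x 0<η
        N′ , y-close       = cauchy y 0<η
        0≤η                = ℚₚ.<⇒≤ 0<η
    in (Nx ℕ.⊔ Ny) ℕ.⊔ (N ℕ.⊔ N′) , λ {m} {n} hm hn →
    let bm , cm = both {Nx ℕ.⊔ Ny} hm
        bn , cn = both {Nx ℕ.⊔ Ny} hn
    in begin
      ∣ (seq x m *ᵠ seq y m) -ᵠ (seq x n *ᵠ seq y n) ∣
        ≤⟨ *-close (seq x m) (seq y m) (seq x n) (seq y n) ⟩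
      ∣ seq x m ∣ *ᵠ ∣ seq y m -ᵠ seq y n ∣ +ᵠ ∣ seq x m -ᵠ seq x n ∣ *ᵠ ∣ seq y n ∣
        ≤⟨ +-mono-≤
             (*-mono (0≤∣p∣ (seq x m)) 0≤η (x≤A (proj₁ (both bm)))
               (y-close (proj₂ (both {N} cm)) (proj₂ (both {N} cn))))
             (*-mono (0≤∣p∣ (seq x m -ᵠ seq x n)) 0≤B
               (x-close (proj₁ (both cm)) (proj₁ (both cn))) (y≤B (proj₂ (both {Nx} bn)))) ⟩
      A *ᵠ η +ᵠ η *ᵠ B
        ≡⟨ solve 3 (λ a b η → a :* η :+ η :* b := (a :+ b) :* η) refl A B η ⟩
      (A +ᵠ B) *ᵠ η
        ≤⟨ η-small ⟩
      ε ∎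

  ⊔-cauchy : ∀ x y → IsCauchy (λ n → seq x n ⊔ᵠ seq y n)
  ⊔-cauchy x y 0<ε = N ℕ.⊔ N′ , λ {m} {n} hm hn →
    ∣-∣-≤ (seq x m ⊔ᵠ seq y m) (seq x n ⊔ᵠ seq y n) (half hm hn) (half hn hm)
    where
    N N′ : ℕ
    N  = proj₁ (cauchy x 0<ε)
    N′ = proj₁ (cauchy y 0<ε)
    half : ∀ {m n} → N ℕ.⊔ N′ ℕ.≤ m → N ℕ.⊔ N′ ℕ.≤ n →
           (seq x m ⊔ᵠ seq y m) ≤ᵠ (seq x n ⊔ᵠ seq y n) +ᵠ _
    half {m} {n} hm hn = ⊔-≤+ (seq x m) (seq y m) (seq x n) (seq y n)
      (∣-∣-≤⇒≤+ (seq x m) (seq x n) (proj₂ (cauchy x 0<ε) (proj₁ (both hm)) (proj₁ (both hn))))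
      (∣-∣-≤⇒≤+ (seq y m) (seq y n) (proj₂ (cauchy y 0<ε) (proj₂ (both {N} hm)) (proj₂ (both {N} hn))))

  recip-cauchy : ∀ x → mkℝ (λ _ → 0ℚ) (const-cauchy 0ℚ) < x →
                 IsCauchy (λ n → recip (seq x n))
  recip-cauchy x (b , 0<b , N₀ , b≤) {ε} 0<ε =
    let η , 0<η , η-small =
          shrink (recip b *ᵠ recip b) ε (0≤* (recip-pos 0<b) (recip-pos 0<b)) 0<ε
        N , close = cauchy x 0<η
    in N₀ ℕ.⊔ N , λ {m} {n} hm hn → begin
    ∣ recip (seq x m) -ᵠ recip (seq x n) ∣
      ≤⟨ recip-close 0<b (b≤x (proj₁ (both hm))) (b≤x (proj₁ (both hn))) ⟩
    (recip b *ᵠ recip b) *ᵠ ∣ seq x m -ᵠ seq x n ∣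
      ≤⟨ *-monoˡ (0≤* (recip-pos 0<b) (recip-pos 0<b))
           (close (proj₂ (both {N₀} hm)) (proj₂ (both {N₀} hn))) ⟩
    (recip b *ᵠ recip b) *ᵠ η
      ≤⟨ η-small ⟩
    ε ∎
    where
    b≤x : ∀ {n} → N₀ ℕ.≤ n → b ≤ᵠ seq x n
    b≤x {n} N₀≤n = subst (_≤ᵠ seq x n) (ℚₚ.+-identityˡ b) (b≤ N₀≤n)

  exp-cauchy : ∀ x → IsCauchy (λ n → expSum (seq x n) n)
  exp-cauchy x = ordered⇒cauchy (λ n → expSum (seq x n) n) (go (bounded x))
    where
    go : ∃[ B ] 0ℚ ≤ᵠ B × ∃[ N ] (∀ {n} → N ℕ.≤ n → ∣ seq x n ∣ ≤ᵠ B) →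
         ∀ {ε} → 0ℚ <ᵠ ε → ∃[ N ] (∀ {m n} → N ℕ.≤ m → m ℕ.≤ n →
         ∣ expSum (seq x m) m -ᵠ expSum (seq x n) n ∣ ≤ᵠ ε)
    go (B , 0≤B , Nb , x≤B) {ε} 0<ε =
      from (shrink (C +ᵠ (1ℚ +ᵠ 1ℚ)) ε (0≤+ 0≤C (0≤+ 0≤1 0≤1)) 0<ε)
      where
      open ExpBounds 0≤B
      from : ∃[ η ] 0ℚ <ᵠ η × (C +ᵠ (1ℚ +ᵠ 1ℚ)) *ᵠ η ≤ᵠ ε →
             ∃[ N ] (∀ {m n} → N ℕ.≤ m → m ℕ.≤ n →
             ∣ expSum (seq x m) m -ᵠ expSum (seq x n) n ∣ ≤ᵠ ε)
      from (η , 0<η , η-small) = Nb ℕ.⊔ (N ℕ.⊔ Nt) , close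
        where
        N Nt : ℕ
        N  = proj₁ (cauchy x 0<η)
        Nt = proj₁ (T-small 0<η)
        close : ∀ {m n} → Nb ℕ.⊔ (N ℕ.⊔ Nt) ℕ.≤ m → m ℕ.≤ n →
                ∣ expSum (seq x m) m -ᵠ expSum (seq x n) n ∣ ≤ᵠ ε
        close {m} {n} hm m≤n = ≤-trans
          (expSum-close (x≤B Nb≤m) (x≤B (ℕₚ.≤-trans Nb≤m m≤n)) (proj₁ small) m≤n
            (proj₂ (cauchy x 0<η) N≤m (ℕₚ.≤-trans N≤m m≤n)) (proj₂ small))
          η-small
          where
          Nb≤m : Nb ℕ.≤ m
          Nb≤m = ℕₚ.m⊔n≤o⇒m≤o Nb (N ℕ.⊔ Nt) hm
          N≤m : N ℕ.≤ m
          N≤m = ℕₚ.m⊔n≤o⇒m≤o N Nt (ℕₚ.m⊔n≤o⇒n≤o Nb (N ℕ.⊔ Nt) hm)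
          small : suc K ℕ.≤ m × expTerm B m ≤ᵠ η
          small = proj₂ (T-small 0<η) (ℕₚ.m⊔n≤o⇒n≤o N Nt (ℕₚ.m⊔n≤o⇒n≤o Nb (N ℕ.⊔ Nt) hm))

open CauchyLemmas

fromℚ : ℚ → ℝ
fromℚ q = mkℝ (λ _ → q) (const-cauchy q)

0ℝ 1ℝ : ℝ
0ℝ = fromℚ 0ℚ
1ℝ = fromℚ 1ℚ

infix  9 _⁻¹
infix  8 -_
infixl 7 _*_
infixl 6 _+_ _-_ _⊔_

_+_ : ℝ → ℝ → ℝ
x + y = mkℝ (λ n → seq x n Rat.+ seq y n) (+-cauchy x y)

-_ : ℝ → ℝ
- x = mkℝ (λ n → Rat.- seq x n) (neg-cauchy x)

_-_ : ℝ → ℝ → ℝ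
x - y = x + (- y)

_*_ : ℝ → ℝ → ℝ
x * y = mkℝ (λ n → seq x n Rat.* seq y n) (*-cauchy x y)

_⊔_ : ℝ → ℝ → ℝ
x ⊔ y = mkℝ (λ n → seq x n Rat.⊔ seq y n) (⊔-cauchy x y)

_⁻¹ : ∀ x → {{0ℝ < x}} → ℝ
_⁻¹ x {{0<x}} = mkℝ (λ n → recip (seq x n)) (recip-cauchy x 0<x)

-- The diagonal sequence n ↦ Σ_{k<n} xₙ^k / k! has limit Σ_k x^k / k!.
exp : ℝ → ℝ
exp x = mkℝ (λ n → expSum (seq x n) n) (exp-cauchy x)

-- Finite simple graphs: an undirected edge is stored with its smaller
-- endpoint first, so edges are loopless and an injective `ends` excludes
-- parallel edges.
record WeightedGraph : Set where
  field
    ∣V∣ ∣E∣        : ℕ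
    ends           : Fin ∣E∣ → Fin ∣V∣ × Fin ∣V∣
    ends-ordered   : ∀ e → proj₁ (ends e) Fin.< proj₂ (ends e)
    ends-injective : Injective _≡_ _≡_ ends
    W              : ℝ
    1≤W            : 1ℝ ≤ W
    w              : Fin ∣E∣ → ℝ
    1≤w            : ∀ e → 1ℝ ≤ w e
    w≤W            : ∀ e → w e ≤ W

subsets : ∀ n → List (Subset n)
subsets zero    = [] ∷ []
subsets (suc n) =
  List.map (outside ∷_) (subsets n) ++ List.map (inside ∷_) (subsets n)

module Matching (G : WeightedGraph) where
  open WeightedGraph G

  Vertex Edge : Set
  Vertex = Fin ∣V∣
  Edge   = Fin ∣E∣

  _∈ends_ : Vertex → Edge → Set
  v ∈ends e = v ≡ proj₁ (ends e) ⊎ v ≡ proj₂ (ends e)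

  Disjoint : Edge → Edge → Set
  Disjoint e f = ∀ v → ¬ (v ∈ends e × v ∈ends f)

  IsMatching : Subset ∣E∣ → Set
  IsMatching M = ∀ e f → e ∈ M → f ∈ M → e ≢ f → Disjoint e f

  -- Matchings of the subgraph whose edges are those satisfying F.
  IsMatchingOf : Pred Edge 0ℓ → Subset ∣E∣ → Set
  IsMatchingOf F M = IsMatching M × (∀ e → e ∈ M → F e)

  isMatchingOf? : ∀ {F} → Decidable F → Decidable (IsMatchingOf F)
  isMatchingOf? F? M =
    (all? λ e → all? λ f → (e ∈? M) →-dec (f ∈? M) →-dec ¬? (e Fin.≟ f) →-dec
      all? λ v → ¬? (v ∈ends? e ×-dec v ∈ends? f))
    ×-dec (all? λ e → (e ∈? M) →-dec F? e)
    where
    _∈ends?_ : ∀ v e → Dec (v ∈ends e)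
    v ∈ends? e = (v Fin.≟ proj₁ (ends e)) ⊎-dec (v Fin.≟ proj₂ (ends e))

  weight : Subset ∣E∣ → ℝ
  weight M = foldr _+_ 0ℝ (λ e → if lookup M e then w e else 0ℝ)

  IsMaxWeightMatchingOf : Pred Edge 0ℓ → Subset ∣E∣ → Set
  IsMaxWeightMatchingOf F M =
    IsMatchingOf F M × (∀ M′ → IsMatchingOf F M′ → weight M′ ≤ weight M)

  -- The starting value 0ℝ is the weight of the empty matching.
  μ : Subset ∣E∣ → ℝ
  μ H = List.foldr _⊔_ 0ℝ
    (List.map weight (filter (isMatchingOf? (_∈? H)) (subsets ∣E∣)))

-- The half-open interval [ℓ, r).
[_,_⟩ : ℝ → ℝ → Pred ℝ 0ℓ
[ ℓ , r ⟩ x = ℓ ≤ x × x < r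

record WeightPartition (G : WeightedGraph) : Set where
  open WeightedGraph G
  field
    k-1        : ℕ

  k : ℕ
  k = suc k-1

  field
    ℓ r        : Fin k → ℝ
    0<ℓ₁       : 0ℝ < ℓ Fin.zero
    ℓ≤r        : ∀ i → ℓ i ≤ r i
    contiguous : ∀ (i : Fin k-1) → ℓ (Fin.suc i) ≈ r (inject₁ i)
    -- The double negation is needed because the order on ℝ is not decidable:
    -- no constructive cover of [1, W] could say which class a given x is in.
    covers     : ∀ x → 1ℝ ≤ x → x ≤ W → ¬ ¬ (∃[ i ] [ ℓ i , r i ⟩ x)

  -- The edge set of G_{[ℓᵢ,rᵢ)}.
  class : Fin k → Pred (Fin ∣E∣) 0ℓ
  class i e = [ ℓ i , r i ⟩ (w e)

{-# OPTIONS --safe #-}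

-- The graph is a disjoint union of gadgets, a gadget of scale 2^u being the path
-- with edge weights 2^(u+1), 2^u, 2^u.  Its optimum is 3 * 2^u, but if a class
-- boundary separates 2^u from 2^(u+1), then the two light edges tie in their
-- class, the choice may fall on the middle one, and only 2 * 2^u survives.  With
-- L ~ 1/δ scales of equal total weight, one separated scale costs a fraction
-- 1/(3L) > δ of the optimum.  Hence no scale is separated, a single class
-- contains both 1 and 2^L, and 2^L ≥ exp(c/δ).
--
-- The order on ℝ being undecidable, the class of each weight is only available
-- under a double negation; the class to be returned is instead found by
-- comparing each rᵢ approximately with ℓᵢ exp(c/δ) < ℓᵢ 2^L.

module Submission where

open import Defs
import Data.Rational as Rat
open import Algebra.Definitions.RawSemiring Rat.+-*-rawSemiring using () renaming (_^_ to _^ᵠ_)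
open import Data.Bool using (Bool; true; false; not; _∧_; if_then_else_)
open import Data.Bool.Properties using (¬-not)
open import Data.Empty using (⊥; ⊥-elim)
open import Data.Fin as Fin using (Fin; zero; suc; toℕ; inject₁; combine; remQuot)
import Data.Fin.Properties as Finₚ
open import Data.Fin.Subset using (Subset; inside; outside; ⊤; ⋃; _∈_)
import Data.Fin.Subset.Properties as Subsetₚ
import Data.Integer as ℤ
open import Data.List as List using (List; []; _∷_; _++_; tabulate)
import Data.List.Membership.Propositional as List∈
import Data.List.Membership.Propositional.Properties as List∈ₚ
open import Data.List.Properties using (map-++)
open import Data.List.Relation.Unary.All as All using (All; []; _∷_)
import Data.List.Relation.Unary.All.Properties as Allₚ
open import Data.List.Relation.Unary.Any using (here; there)
open import Data.Nat as ℕ using (ℕ; zero; suc)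
open import Data.Nat.ListAction using (sum)
open import Data.Nat.ListAction.Properties using (sum-++)
import Data.Nat.Properties as ℕₚ
import Data.Nat.Solver as ℕ-Solver
open import Data.Product using (∃-syntax; _×_; _,_; proj₁; proj₂; Σ-syntax; uncurry)
open import Data.Product.Properties using (,-injective)
open Rat using (ℚ; 0ℚ; 1ℚ; ½)
  renaming (_+_ to _+ᵠ_; _*_ to _*ᵠ_; _-_ to _-ᵠ_; -_ to -ᵠ_; ∣_∣ to ∣_∣ᵠ; _≤_ to _≤ᵠ_; _<_ to _<ᵠ_)
import Data.Rational.Properties as ℚₚ
import Data.Rational.Solver as ℚ-Solver
open import Data.Sum using (_⊎_; inj₁; inj₂; [_,_]′)
open import Data.Vec as Vec using (lookup; []; _∷_)
open import Data.Vec.Functional using (Vector; foldr)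
import Data.Vec.Properties as Vecₚ
open import Function using (_∘_)
open import Relation.Binary.Definitions using (tri<; tri≈; tri>)
open import Relation.Binary.PropositionalEquality
  using (_≡_; _≢_; refl; sym; trans; cong; cong₂; subst; subst₂)
open import Relation.Nullary using (¬_; does; yes; no; contradiction)
open import Relation.Nullary.Decidable using (dec-true; dec-false; from-yes; from-no)
open RationalLemmas

-- Order on the Cauchy reals.

Eventually : (ℕ → Set) → Set
Eventually P = ∃[ N ] (∀ {n} → N ℕ.≤ n → P n)

eventually-× : ∀ {P Q} → Eventually P → Eventually Q → Eventually (λ n → P n × Q n)
eventually-× (N , p) (N′ , q) = N ℕ.⊔ N′ , λ h →
  p (ℕₚ.m⊔n≤o⇒m≤o N N′ h) , q (ℕₚ.m⊔n≤o⇒n≤o N N′ h)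

eventually-map : ∀ {P Q : ℕ → Set} → (∀ {n} → P n → Q n) → Eventually P → Eventually Q
eventually-map f (N , p) = N , λ h → f (p h)

halve : ∀ ε → 0ℚ <ᵠ ε → ∃[ η ] 0ℚ <ᵠ η × (1ℚ +ᵠ 1ℚ) *ᵠ η ≤ᵠ ε
halve ε = shrink (1ℚ +ᵠ 1ℚ) ε (0≤+ 0≤1 0≤1)

≤ᵠ⇒≤ : ∀ {p q} → p ≤ᵠ q → fromℚ p ≤ fromℚ q
≤ᵠ⇒≤ p≤q 0<ε = 0 , λ _ → ℚₚ.≤-trans p≤q (p≤p+q (ℚₚ.<⇒≤ 0<ε))

≤-trans : ∀ x y z → x ≤ y → y ≤ z → x ≤ z
≤-trans x y z x≤y y≤z {ε} 0<ε =
  let η , 0<η , 2η≤ε = halve ε 0<ε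
  in eventually-map (λ {n} (p , q) → begin
       seq x n                       ≤⟨ p ⟩
       seq y n +ᵠ η                  ≤⟨ ℚₚ.+-monoˡ-≤ η q ⟩
       (seq z n +ᵠ η) +ᵠ η           ≡⟨ solve 2 (λ z η → (z :+ η) :+ η := z :+ (con 1ℚ :+ con 1ℚ) :* η)
                                         refl (seq z n) η ⟩
       seq z n +ᵠ (1ℚ +ᵠ 1ℚ) *ᵠ η    ≤⟨ ℚₚ.+-monoʳ-≤ (seq z n) 2η≤ε ⟩
       seq z n +ᵠ ε                  ∎)
     (eventually-× (x≤y 0<η) (y≤z 0<η))
  where
  open ℚₚ.≤-Reasoning
  open ℚ-Solver.+-*-Solver

<-≤-absurd : ∀ x y → x < y → y ≤ x → ⊥
<-≤-absurd x y (ε , 0<ε , x<y) y≤x =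
  let η , 0<η , 2η≤ε = halve ε 0<ε
      N , h = eventually-× x<y (y≤x 0<η)
      p , q = h ℕₚ.≤-refl
      2η≤η = ℚₚ.≤-trans 2η≤ε (cancel (seq x N) ε η (ℚₚ.≤-trans p q))
  in ℚₚ.<-irrefl refl (ℚₚ.<-≤-trans 0<η (subst (_≤ᵠ 0ℚ)
       (solve 1 (λ η → (con 1ℚ :+ con 1ℚ) :* η :- η := η) refl η)
       (≤+⇒-≤ (subst ((1ℚ +ᵠ 1ℚ) *ᵠ η ≤ᵠ_) (sym (ℚₚ.+-identityʳ η)) 2η≤η))))
  where
  open ℚ-Solver.+-*-Solver
  cancel : ∀ p q r → p +ᵠ q ≤ᵠ p +ᵠ r → q ≤ᵠ r
  cancel p q r h = subst (_≤ᵠ r)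
    (solve 2 (λ p q → (p :+ q) :- p := q) refl p q) (≤+⇒-≤ h)

<-≤-trans : ∀ x y z → x < y → y ≤ z → x < z
<-≤-trans x y z (ε , 0<ε , x<y) y≤z =
  let η , 0<η , 2η≤ε = halve ε 0<ε
  in η , 0<η , eventually-map (λ {n} (p , q) → begin
       seq x n +ᵠ η                       ≡⟨ solve 2 (λ x η → x :+ η := (x :+ (con 1ℚ :+ con 1ℚ) :* η) :- η)
                                              refl (seq x n) η ⟩
       (seq x n +ᵠ (1ℚ +ᵠ 1ℚ) *ᵠ η) -ᵠ η  ≤⟨ ℚₚ.+-monoˡ-≤ (-ᵠ η) (ℚₚ.+-monoʳ-≤ (seq x n) 2η≤ε) ⟩
       (seq x n +ᵠ ε) -ᵠ η                ≤⟨ ℚₚ.+-monoˡ-≤ (-ᵠ η) (ℚₚ.≤-trans p q) ⟩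
       (seq z n +ᵠ η) -ᵠ η                ≡⟨ solve 2 (λ z η → (z :+ η) :- η := z) refl (seq z n) η ⟩
       seq z n                            ∎)
     (eventually-× x<y (y≤z 0<η))
  where
  open ℚₚ.≤-Reasoning
  open ℚ-Solver.+-*-Solver

-- A constructive substitute for deciding the order: one of the two weak
-- inequalities is read off from sufficiently good approximations.
cotransitive : ∀ x y z → x < y → x ≤ z ⊎ z ≤ y
cotransitive x y z (ε , 0<ε , N₀ , x<y) = go (shrink (fromℕ 4) ε (0≤fromℕ 4) 0<ε)
  where
  open ℚₚ.≤-Reasoning
  open ℚ-Solver.+-*-Solver
  go : ∃[ η ] 0ℚ <ᵠ η × fromℕ 4 *ᵠ η ≤ᵠ ε → x ≤ z ⊎ z ≤ y
  -- One rational comparison at index `N` suffices. If Z ≥ X + 2η, the margin absorbs the two Cauchy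
  -- errors; otherwise these errors raise 2η to 4η ≤ ε, which still stays below `y`.
  go (η , 0<η , 4η≤ε) = decide (ℚₚ.≤-total (X +ᵠ (η +ᵠ η)) Z)
    where
    Nx Nz N : ℕ
    Nx = proj₁ (cauchy x 0<η)
    Nz = proj₁ (cauchy z 0<η)
    N  = N₀ ℕ.⊔ (Nx ℕ.⊔ Nz)
    X Z : ℚ
    X = seq x N
    Z = seq z N
    N₀≤ : ∀ {n} → N ℕ.≤ n → N₀ ℕ.≤ n
    N₀≤ = ℕₚ.m⊔n≤o⇒m≤o N₀ (Nx ℕ.⊔ Nz)
    Nx≤ : ∀ {n} → N ℕ.≤ n → Nx ℕ.≤ n
    Nx≤ h = ℕₚ.m⊔n≤o⇒m≤o Nx Nz (ℕₚ.m⊔n≤o⇒n≤o N₀ (Nx ℕ.⊔ Nz) h)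
    Nz≤ : ∀ {n} → N ℕ.≤ n → Nz ℕ.≤ n
    Nz≤ h = ℕₚ.m⊔n≤o⇒n≤o Nx Nz (ℕₚ.m⊔n≤o⇒n≤o N₀ (Nx ℕ.⊔ Nz) h)
    x-close : ∀ {m n} → N ℕ.≤ m → N ℕ.≤ n → seq x m ≤ᵠ seq x n +ᵠ η
    x-close {m} {n} hm hn = ∣-∣-≤⇒≤+ (seq x m) (seq x n) (proj₂ (cauchy x 0<η) (Nx≤ hm) (Nx≤ hn))
    z-close : ∀ {m n} → N ℕ.≤ m → N ℕ.≤ n → seq z m ≤ᵠ seq z n +ᵠ η
    z-close {m} {n} hm hn = ∣-∣-≤⇒≤+ (seq z m) (seq z n) (proj₂ (cauchy z 0<η) (Nz≤ hm) (Nz≤ hn))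
    decide : X +ᵠ (η +ᵠ η) ≤ᵠ Z ⊎ Z ≤ᵠ X +ᵠ (η +ᵠ η) → x ≤ z ⊎ z ≤ y
    decide (inj₁ X≤Z) = inj₁ λ {ε′} 0<ε′ → N , λ {n} N≤n → begin
      seq x n                     ≤⟨ x-close N≤n ℕₚ.≤-refl ⟩
      X +ᵠ η                      ≡⟨ solve 2 (λ x η → x :+ η := (x :+ (η :+ η)) :- η) refl X η ⟩
      (X +ᵠ (η +ᵠ η)) -ᵠ η        ≤⟨ ℚₚ.+-monoˡ-≤ (-ᵠ η) (ℚₚ.≤-trans X≤Z (z-close ℕₚ.≤-refl N≤n)) ⟩
      (seq z n +ᵠ η) -ᵠ η         ≡⟨ solve 2 (λ z η → (z :+ η) :- η := z) refl (seq z n) η ⟩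
      seq z n                     ≤⟨ p≤p+q (ℚₚ.<⇒≤ 0<ε′) ⟩
      seq z n +ᵠ ε′               ∎
    decide (inj₂ Z≤X) = inj₂ λ {ε′} 0<ε′ → N , λ {n} N≤n → begin
      seq z n                     ≤⟨ z-close N≤n ℕₚ.≤-refl ⟩
      Z +ᵠ η                      ≤⟨ ℚₚ.+-monoˡ-≤ η Z≤X ⟩
      (X +ᵠ (η +ᵠ η)) +ᵠ η        ≤⟨ ℚₚ.+-monoˡ-≤ η (ℚₚ.+-monoˡ-≤ (η +ᵠ η) (x-close ℕₚ.≤-refl N≤n)) ⟩
      ((seq x n +ᵠ η) +ᵠ (η +ᵠ η)) +ᵠ η
        ≡⟨ solve 2 (λ x η → ((x :+ η) :+ (η :+ η)) :+ η :=
             x :+ (con (fromℕ 4) :* η)) refl (seq x n) η ⟩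
      seq x n +ᵠ fromℕ 4 *ᵠ η     ≤⟨ ℚₚ.+-monoʳ-≤ (seq x n) 4η≤ε ⟩
      seq x n +ᵠ ε                ≤⟨ x<y (N₀≤ N≤n) ⟩
      seq y n                     ≤⟨ p≤p+q (ℚₚ.<⇒≤ 0<ε′) ⟩
      seq y n +ᵠ ε′               ∎

-- Growth of the partial sums of the exponential series.

expSum-mono : ∀ {p q} → 0ℚ ≤ᵠ p → p ≤ᵠ q → ∀ n → expSum p n ≤ᵠ expSum q n
expSum-mono 0≤p p≤q zero    = ℚₚ.≤-refl
expSum-mono {p} {q} 0≤p p≤q (suc n) = ℚₚ.+-mono-≤ (expSum-mono 0≤p p≤q n)
  (ℚₚ.≤-trans (p≤∣p∣ (expTerm p n))
    (ExpBounds.∣expTerm∣≤ (ℚₚ.≤-trans 0≤p p≤q)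
      (subst (_≤ᵠ q) (sym (ℚₚ.0≤p⇒∣p∣≡p 0≤p)) p≤q) n))

expSum-0 : ∀ n → expSum 0ℚ n ≤ᵠ 1ℚ
expSum-0 zero          = 0≤1
expSum-0 (suc zero)    = ℚₚ.≤-refl
expSum-0 (suc (suc n)) = subst (_≤ᵠ 1ℚ)
  (sym (trans (cong (expSum 0ℚ (suc n) +ᵠ_) term≡0) (ℚₚ.+-identityʳ (expSum 0ℚ (suc n)))))
  (expSum-0 (suc n))
  where
  term≡0 : expTerm 0ℚ (suc n) ≡ 0ℚ
  term≡0 = trans (cong (_*ᵠ r) (ℚₚ.*-zeroˡ (0ℚ ^ᵠ n))) (ℚₚ.*-zeroˡ r)
    where
    r : ℚ
    r = recip (fromℕ (suc n ℕ.!))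

-- For every partial sum S of the exponential series, the Lipschitz bound gives
-- S(q + ½) - S(q) ≤ ½ S(q + ½).
expSum-+½ : ∀ {q} → 0ℚ ≤ᵠ q → ∀ n → expSum (q +ᵠ ½) n ≤ᵠ (1ℚ +ᵠ 1ℚ) *ᵠ expSum q n
expSum-+½ {q} 0≤q n = begin
  X                              ≡⟨ solve 1 (λ x → x := (con 1ℚ :+ con 1ℚ) :* (x :- con ½ :* x)) refl X ⟩
  (1ℚ +ᵠ 1ℚ) *ᵠ (X -ᵠ ½ *ᵠ X)    ≤⟨ *-monoˡ (0≤+ 0≤1 0≤1) (≤+⇒-≤ X≤) ⟩
  (1ℚ +ᵠ 1ℚ) *ᵠ Y                ∎
  where
  open ℚₚ.≤-Reasoning
  open ℚ-Solver.+-*-Solver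
  B X Y : ℚ
  B = q +ᵠ ½
  X = expSum B n
  Y = expSum q n
  0≤½ : 0ℚ ≤ᵠ ½
  0≤½ = ℚₚ.nonNegative⁻¹ ½
  0≤B : 0ℚ ≤ᵠ B
  0≤B = 0≤+ 0≤q 0≤½
  open ExpBounds 0≤B
  pred≤ : ∀ n → Σₜ (ℕ.pred n) ≤ᵠ Σₜ n
  pred≤ zero    = ℚₚ.≤-refl
  pred≤ (suc n) = p≤p+q (0≤T n)
  gap : ∣ B -ᵠ q ∣ᵠ ≡ ½
  gap = cong ∣_∣ᵠ (solve 1 (λ q → (q :+ con ½) :- q := con ½) refl q)
  X≤ : X ≤ᵠ ½ *ᵠ X +ᵠ Y
  X≤ = begin
    X                                        ≤⟨ ≤+∣-∣ X Y ⟩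
    Y +ᵠ ∣ X -ᵠ Y ∣ᵠ                          ≤⟨ ℚₚ.+-monoʳ-≤ Y (expSum-lipschitz
                                                  (ℚₚ.≤-reflexive (ℚₚ.0≤p⇒∣p∣≡p 0≤B))
                                                  (subst (_≤ᵠ B) (sym (ℚₚ.0≤p⇒∣p∣≡p 0≤q)) (p≤p+q 0≤½)) n) ⟩
    Y +ᵠ ∣ B -ᵠ q ∣ᵠ *ᵠ Σₜ (ℕ.pred n)         ≡⟨ cong (λ z → Y +ᵠ z *ᵠ Σₜ (ℕ.pred n)) gap ⟩
    Y +ᵠ ½ *ᵠ Σₜ (ℕ.pred n)                   ≤⟨ ℚₚ.+-monoʳ-≤ Y (*-monoˡ 0≤½ (pred≤ n)) ⟩
    Y +ᵠ ½ *ᵠ X                              ≡⟨ ℚₚ.+-comm Y (½ *ᵠ X) ⟩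
    ½ *ᵠ X +ᵠ Y                              ∎

-- Each step of ½ in the argument at most doubles a partial sum. The bound is uniform in `n`, as
-- required by the diagonal sequence that defines `exp`.
expSum-≤-2^ : ∀ m n → expSum (fromℕ m *ᵠ ½) n ≤ᵠ fromℕ (2 ℕ.^ m)
expSum-≤-2^ zero n = expSum-0 n
expSum-≤-2^ (suc m) n = begin
  expSum ((1ℚ +ᵠ fromℕ m) *ᵠ ½) n
    ≡⟨ cong (λ q → expSum q n) (solve 1 (λ m → (con 1ℚ :+ m) :* con ½ := m :* con ½ :+ con ½) refl (fromℕ m)) ⟩
  expSum (fromℕ m *ᵠ ½ +ᵠ ½) n
    ≤⟨ expSum-+½ (0≤* (0≤fromℕ m) (ℚₚ.nonNegative⁻¹ ½)) n ⟩
  (1ℚ +ᵠ 1ℚ) *ᵠ expSum (fromℕ m *ᵠ ½) n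
    ≤⟨ *-monoˡ (0≤+ 0≤1 0≤1) (expSum-≤-2^ m n) ⟩
  (1ℚ +ᵠ 1ℚ) *ᵠ fromℕ (2 ℕ.^ m)
    ≡⟨ fromℕ-* 2 (2 ℕ.^ m) ⟨
  fromℕ (2 ℕ.^ suc m) ∎
  where
  open ℚₚ.≤-Reasoning
  open ℚ-Solver.+-*-Solver

-- Finite sums, maxima and unions.

Σᶠ : ∀ {n} → Vector ℕ n → ℕ
Σᶠ = foldr ℕ._+_ 0

Σᶠ-mono : ∀ {n} {f g : Vector ℕ n} → (∀ i → f i ℕ.≤ g i) → Σᶠ f ℕ.≤ Σᶠ g
Σᶠ-mono {zero}  f≤g = ℕ.z≤n
Σᶠ-mono {suc n} f≤g = ℕₚ.+-mono-≤ (f≤g zero) (Σᶠ-mono (λ i → f≤g (suc i)))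

Σᶠ-lookup : ∀ (f : ℕ → ℕ) xs → Σᶠ (λ j → f (List.lookup xs j)) ≡ sum (List.map f xs)
Σᶠ-lookup f []       = refl
Σᶠ-lookup f (x ∷ xs) = cong (f x ℕ.+_) (Σᶠ-lookup f xs)

-- Regroups a sum over all edges by gadget: `combine j t` is edge number t of gadget j.
Σᶠ-triples : ∀ n (f : Vector ℕ (n ℕ.* 3)) → Σᶠ f ≡ Σᶠ {n} (λ j →
  f (combine j zero) ℕ.+ (f (combine j (suc zero)) ℕ.+ f (combine j (suc (suc zero)))))
Σᶠ-triples zero    f = refl
Σᶠ-triples (suc n) f = trans
  (cong (λ s → a ℕ.+ (b ℕ.+ (c ℕ.+ s))) (Σᶠ-triples n (λ e → f (suc (suc (suc e))))))
  (solve 4 (λ a b c s → a :+ (b :+ (c :+ s)) := (a :+ (b :+ c)) :+ s) refl a b c _)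
  where
  open ℕ-Solver.+-*-Solver
  a b c : ℕ
  a = f zero
  b = f (suc zero)
  c = f (suc (suc zero))

-- The weights to be summed are constant sequences of naturals, so weights of matchings can be
-- compared in ℕ.
seq-foldr-+ : ∀ {m} (x : Vector ℝ m) (f : Vector ℕ m) n → (∀ i → seq (x i) n ≡ fromℕ (f i)) →
              seq (foldr _+_ 0ℝ x) n ≡ fromℕ (Σᶠ f)
seq-foldr-+ {zero}  x f n eq = refl
seq-foldr-+ {suc m} x f n eq = trans
  (cong₂ _+ᵠ_ (eq zero) (seq-foldr-+ (λ i → x (suc i)) (λ i → f (suc i)) n (λ i → eq (suc i))))
  (sym (fromℕ-+ (f zero) _))

∈-subsets : ∀ {n} (M : Subset n) → M List∈.∈ subsets n
∈-subsets []            = here refl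
∈-subsets (outside ∷ M) = List∈ₚ.∈-++⁺ˡ (List∈ₚ.∈-map⁺ (outside ∷_) (∈-subsets M))
∈-subsets (inside ∷ M)  =
  List∈ₚ.∈-++⁺ʳ (List.map (outside ∷_) (subsets _)) (List∈ₚ.∈-map⁺ (inside ∷_) (∈-subsets M))

seq-⊔-upper : ∀ {x} xs n → x List∈.∈ xs → seq x n ≤ᵠ seq (List.foldr _⊔_ 0ℝ xs) n
seq-⊔-upper (x ∷ xs) n (here refl) = ℚₚ.p≤p⊔q (seq x n) _
seq-⊔-upper (x ∷ xs) n (there x∈)  =
  ℚₚ.≤-trans (seq-⊔-upper xs n x∈) (ℚₚ.p≤q⊔p (seq x n) _)

seq-⊔-least : ∀ {q} xs n → 0ℚ ≤ᵠ q → (∀ x → x List∈.∈ xs → seq x n ≤ᵠ q) →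
              seq (List.foldr _⊔_ 0ℝ xs) n ≤ᵠ q
seq-⊔-least []       n 0≤q x≤q = 0≤q
seq-⊔-least (x ∷ xs) n 0≤q x≤q =
  ℚₚ.⊔-lub (x≤q x (here refl)) (seq-⊔-least xs n 0≤q (λ y y∈ → x≤q y (there y∈)))

∈⇒lookup : ∀ {n} {M : Subset n} {e} → e ∈ M → lookup M e ≡ true
∈⇒lookup = Vecₚ.[]=⇒lookup

lookup⇒∈ : ∀ {n} {M : Subset n} {e} → lookup M e ≡ true → e ∈ M
lookup⇒∈ {M = M} {e} = Vecₚ.lookup⇒[]= e M

∈-⋃⁻ : ∀ {n k} {e : Fin n} (M : Fin k → Subset n) → e ∈ ⋃ (List.tabulate M) → ∃[ i ] e ∈ M i
∈-⋃⁻ {k = zero}  M e∈ = contradiction e∈ Subsetₚ.∉⊥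
∈-⋃⁻ {k = suc k} M e∈ with Subsetₚ.x∈p∪q⁻ (M zero) _ e∈
... | inj₁ e∈M₀ = zero , e∈M₀
... | inj₂ e∈M⁺ = let i , e∈Mᵢ = ∈-⋃⁻ (λ i → M (suc i)) e∈M⁺ in suc i , e∈Mᵢ

module MatchingNumber (G : WeightedGraph) where
  open WeightedGraph G
  open Matching G

  -- The maximum on ℝ is taken entrywise, so this bound and the next hold at every index, without a
  -- tolerance.
  weight≤μ : ∀ H M n → IsMatchingOf (_∈ H) M → seq (weight M) n ≤ᵠ seq (μ H) n
  weight≤μ H M n m = seq-⊔-upper (List.map weight _) n
    (List∈ₚ.∈-map⁺ weight (List∈ₚ.∈-filter⁺ (isMatchingOf? (Subsetₚ._∈? H)) (∈-subsets M) m))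

  μ≤ : ∀ H n {q} → 0ℚ ≤ᵠ q → (∀ M → IsMatchingOf (_∈ H) M → seq (weight M) n ≤ᵠ q) →
       seq (μ H) n ≤ᵠ q
  μ≤ H n {q} 0≤q h = seq-⊔-least (List.map weight _) n 0≤q λ x x∈ →
    let M , M∈ , x≡ = List∈ₚ.∈-map⁻ weight x∈
        m = proj₂ (List∈ₚ.∈-filter⁻ (isMatchingOf? (Subsetₚ._∈? H)) {xs = subsets ∣E∣} M∈)
    in subst (λ y → seq y n ≤ᵠ q) (sym x≡) (h M m)

-- Powers of two as weights, and selections within one gadget.

pw : ℕ → ℝ
pw u = fromℚ (fromℕ (2 ℕ.^ u))

pw-mono : ∀ {u v} → u ℕ.≤ v → pw u ≤ pw v
pw-mono u≤v = ≤ᵠ⇒≤ (fromℕ-mono (ℕₚ.^-monoʳ-≤ 2 u≤v))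

-- The weight of the selected edges in a gadget of scale p, where the selection
-- is given by the edges of weight 2p, p, p in the order in which the path
-- traverses them.
gadgetWeight : ℕ → Bool → Bool → Bool → ℕ
gadgetWeight p a b c =
  (if a then 2 ℕ.* p else 0) ℕ.+ ((if b then p else 0) ℕ.+ (if c then p else 0))

Exclusive : Bool → Bool → Set
Exclusive a b = a ≡ true → b ≡ true → ⊥

gadgetWeight-101 : ∀ p → gadgetWeight p true false true ≡ 3 ℕ.* p
gadgetWeight-101 = solve 1 (λ p → con 2 :* p :+ (con 0 :+ p) := con 3 :* p) refl
  where open ℕ-Solver.+-*-Solver

gadgetWeight-10 : ∀ p → gadgetWeight p true false false ≡ 2 ℕ.* p
gadgetWeight-10 p = ℕₚ.+-identityʳ (2 ℕ.* p)

gadgetWeight-≤2 : ∀ p a b → Exclusive a b → gadgetWeight p a b false ℕ.≤ 2 ℕ.* p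
gadgetWeight-≤2 p true  true  ab = contradiction refl (ab refl)
gadgetWeight-≤2 p true  false ab = ℕₚ.≤-reflexive (gadgetWeight-10 p)
gadgetWeight-≤2 p false true  ab = ℕₚ.+-monoʳ-≤ p ℕ.z≤n
gadgetWeight-≤2 p false false ab = ℕ.z≤n

gadgetWeight-≤3 : ∀ p a b c → Exclusive a b → Exclusive b c → gadgetWeight p a b c ℕ.≤ 3 ℕ.* p
gadgetWeight-≤3 p a     b     false ab bc =
  ℕₚ.≤-trans (gadgetWeight-≤2 p a b ab) (ℕₚ.m≤n+m (2 ℕ.* p) p)
gadgetWeight-≤3 p a     true  true  ab bc = contradiction refl (bc refl)
gadgetWeight-≤3 p true  false true  ab bc = ℕₚ.≤-reflexive (gadgetWeight-101 p)
gadgetWeight-≤3 p false false true  ab bc = ℕₚ.m≤m+n p (2 ℕ.* p)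

-- A and B say which of the weights 2p and p lie in the class at hand.
gadgetWeight-max : ∀ p {a b c} A B h →
  (a ≡ true → A ≡ true) → (b ≡ true → B ≡ true) → (c ≡ true → B ≡ true) →
  Exclusive a b → Exclusive b c → (A ≡ true → B ≡ true → h ≡ false) →
  gadgetWeight p a b c ℕ.≤ gadgetWeight p (A ∧ true) (B ∧ h) (B ∧ not h)
-- With both weights in the class, h is false and the outer pair attains 3p. With the heavy weight
-- alone only the first edge is available. With the light weight alone at most one of two adjacent
-- edges fits, and either is worth p, so h is free.
gadgetWeight-max p {a} {b} {c} true true h a⇒ b⇒ c⇒ ab bc AB with h | AB refl refl
... | false | refl = ℕₚ.≤-trans (gadgetWeight-≤3 p a b c ab bc)
                       (ℕₚ.≤-reflexive (sym (gadgetWeight-101 p)))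
gadgetWeight-max p {b = true} A false h a⇒ b⇒ c⇒ ab bc AB = contradiction (b⇒ refl) λ ()
gadgetWeight-max p {b = false} {true} A false h a⇒ b⇒ c⇒ ab bc AB = contradiction (c⇒ refl) λ ()
gadgetWeight-max p {true} {false} {false} A false h a⇒ b⇒ c⇒ ab bc AB with A | a⇒ refl
... | true | refl = ℕₚ.≤-refl
gadgetWeight-max p {false} {false} {false} A false h a⇒ b⇒ c⇒ ab bc AB = ℕ.z≤n
gadgetWeight-max p {true} false true h a⇒ b⇒ c⇒ ab bc AB = contradiction (a⇒ refl) λ ()
gadgetWeight-max p {false} {true} {true} false true h a⇒ b⇒ c⇒ ab bc AB = contradiction refl (bc refl)
gadgetWeight-max p {false} {b} {c} false true h a⇒ b⇒ c⇒ ab bc AB = begin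
  gadgetWeight p false b c                   ≤⟨ ≤p b c bc ⟩
  p                                          ≤⟨ p≤ h ⟩
  gadgetWeight p false h (not h)             ∎
  where
  open ℕₚ.≤-Reasoning
  ≤p : ∀ b c → Exclusive b c → gadgetWeight p false b c ℕ.≤ p
  ≤p true  true  bc = contradiction refl (bc refl)
  ≤p true  false bc = ℕₚ.≤-reflexive (ℕₚ.+-identityʳ p)
  ≤p false true  bc = ℕₚ.≤-refl
  ≤p false false bc = ℕ.z≤n
  p≤ : ∀ h → p ℕ.≤ gadgetWeight p false h (not h)
  p≤ true  = ℕₚ.m≤m+n p 0
  p≤ false = ℕₚ.≤-refl

-- The disjoint union of gadgets and its matchings.

module GadgetGraph (L : ℕ) (xs : List ℕ) (xs<L : All (ℕ._< L) xs) where

  N : ℕ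
  N = List.length xs

  σ : Fin N → ℕ
  σ = List.lookup xs

  σ<L : ∀ j → σ j ℕ.< L
  σ<L j = All.lookup xs<L (List∈ₚ.∈-lookup j)

  exponent : Fin N × Fin 3 → ℕ
  exponent (j , zero)  = suc (σ j)
  exponent (j , suc _) = σ j

  exponent≤L : ∀ jt → exponent jt ℕ.≤ L
  exponent≤L (j , zero)  = σ<L j
  exponent≤L (j , suc _) = ℕₚ.<⇒≤ (σ<L j)

  edge : Fin N → Fin 3 → Fin (N ℕ.* 3)
  edge = combine

  path : Fin N × Fin 3 → Fin (N ℕ.* 4) × Fin (N ℕ.* 4)
  path (j , t) = combine j (inject₁ t) , combine j (suc t)

  path-ordered : ∀ jt → proj₁ (path jt) Fin.< proj₂ (path jt)
  path-ordered (j , t) = subst₂ ℕ._<_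
    (sym (trans (Finₚ.toℕ-combine j (inject₁ t)) (cong (4 ℕ.* toℕ j ℕ.+_) (Finₚ.toℕ-inject₁ t))))
    (sym (Finₚ.toℕ-combine j (suc t)))
    (ℕₚ.+-monoʳ-< (4 ℕ.* toℕ j) (ℕₚ.n<1+n (toℕ t)))

  path-injective : ∀ {jt jt′} → path jt ≡ path jt′ → jt ≡ jt′
  path-injective {j , t} {j′ , t′} eq =
    let j≡ , t≡ = Finₚ.combine-injective j (suc t) j′ (suc t′) (proj₂ (,-injective eq))
    in cong₂ _,_ j≡ (Finₚ.suc-injective t≡)

  remQuot-injective : ∀ {e f : Fin (N ℕ.* 3)} → remQuot {N} 3 e ≡ remQuot 3 f → e ≡ f
  remQuot-injective {e} {f} eq = trans (sym (Finₚ.combine-remQuot {N} 3 e))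
    (trans (cong (uncurry combine) eq) (Finₚ.combine-remQuot {N} 3 f))

  G : WeightedGraph
  G = record
    { ∣V∣ = N ℕ.* 4
    ; ∣E∣ = N ℕ.* 3
    ; ends = λ e → path (remQuot 3 e)
    ; ends-ordered = λ e → path-ordered (remQuot 3 e)
    ; ends-injective = λ eq → remQuot-injective (path-injective eq)
    ; W = pw L
    ; 1≤W = pw-mono {0} {L} ℕ.z≤n
    ; w = λ e → pw (exponent (remQuot 3 e))
    ; 1≤w = λ e → pw-mono {0} {exponent (remQuot 3 e)} ℕ.z≤n
    ; w≤W = λ e → pw-mono (exponent≤L (remQuot 3 e))
    }

  open WeightedGraph G using (∣E∣; ends)
  open Matching G
  open MatchingNumber G

  exponent-edge : ∀ j t → exponent (remQuot 3 (edge j t)) ≡ exponent (j , t)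
  exponent-edge j t = cong exponent (Finₚ.remQuot-combine j t)

  ends-edge : ∀ j t → ends (edge j t) ≡ path (j , t)
  ends-edge j t = cong path (Finₚ.remQuot-combine j t)

  -- A Boolean form of `IsMatching`, suited to case analysis on a gadget: the paths are
  -- vertex-disjoint, so conflicts occur only between consecutive edges of one path.
  NonAdjacent : Subset ∣E∣ → Set
  NonAdjacent M = ∀ j (t : Fin 2) → Exclusive (lookup M (edge j (inject₁ t))) (lookup M (edge j (suc t)))

  matching⇒nonAdjacent : ∀ {M} → IsMatching M → NonAdjacent M
  matching⇒nonAdjacent m j t e∈ f∈ = m (edge j (inject₁ t)) (edge j (suc t))
    (lookup⇒∈ e∈) (lookup⇒∈ f∈)
    (λ eq → inject₁≢suc t (Finₚ.combine-injectiveʳ j (inject₁ t) j (suc t) eq))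
    -- The common vertex: `inject₁ (suc t)` computes to `suc (inject₁ t)`, so the second end of one
    -- edge is the first end of the next.
    (combine j (suc (inject₁ t)))
    ( inj₂ (sym (cong proj₂ (ends-edge j (inject₁ t))))
    , inj₁ (sym (cong proj₁ (ends-edge j (suc t)))))
    where
    inject₁≢suc : ∀ {n} (t : Fin n) → inject₁ t ≢ suc t
    inject₁≢suc (suc t) eq = inject₁≢suc t (Finₚ.suc-injective eq)

  -- A vertex determines its gadget and its position there. If it is the same end of both edges,
  -- they coincide; if it is opposite ends, they are consecutive.
  nonAdjacent⇒matching : ∀ {M} → NonAdjacent M → IsMatching M
  nonAdjacent⇒matching {M} na e f e∈ f∈ e≢f v (v∈e , v∈f)
    with j , t , refl ← Finₚ.combine-surjective {N} {3} e
       | j′ , t′ , refl ← Finₚ.combine-surjective {N} {3} f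
    = cases (subst (λ p → v ≡ proj₁ p ⊎ v ≡ proj₂ p) (ends-edge j t) v∈e)
            (subst (λ p → v ≡ proj₁ p ⊎ v ≡ proj₂ p) (ends-edge j′ t′) v∈f)
    where
    consecutive : ∀ {j j′ t t′} → edge j t ∈ M → edge j′ t′ ∈ M → j ≡ j′ → suc t ≡ inject₁ t′ → ⊥
    consecutive {j} {t = t} {suc t′} e∈ f∈ refl eq with refl ← Finₚ.suc-injective eq =
      na j t′ (∈⇒lookup e∈) (∈⇒lookup f∈)

    cases : v ≡ combine j (inject₁ t) ⊎ v ≡ combine j (suc t) →
            v ≡ combine j′ (inject₁ t′) ⊎ v ≡ combine j′ (suc t′) → ⊥
    cases (inj₁ p) (inj₁ q) =
      let j≡ , t≡ = Finₚ.combine-injective j (inject₁ t) j′ (inject₁ t′) (trans (sym p) q)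
      in e≢f (cong₂ combine j≡ (Finₚ.inject₁-injective t≡))
    cases (inj₂ p) (inj₂ q) =
      let j≡ , t≡ = Finₚ.combine-injective j (suc t) j′ (suc t′) (trans (sym p) q)
      in e≢f (cong₂ combine j≡ (Finₚ.suc-injective t≡))
    cases (inj₂ p) (inj₁ q) =
      let j≡ , t≡ = Finₚ.combine-injective j (suc t) j′ (inject₁ t′) (trans (sym p) q)
      in consecutive e∈ f∈ j≡ t≡
    cases (inj₁ p) (inj₂ q) =
      let j≡ , t≡ = Finₚ.combine-injective j′ (suc t′) j (inject₁ t) (trans (sym q) p)
      in consecutive f∈ e∈ j≡ t≡

  scale : Fin N → ℕ
  scale j = 2 ℕ.^ σ j

  weightAt : Subset ∣E∣ → Fin N → ℕ
  weightAt M j = gadgetWeight (scale j)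
    (lookup M (edge j zero)) (lookup M (edge j (suc zero))) (lookup M (edge j (suc (suc zero))))

  seq-weight : ∀ M n → seq (weight M) n ≡ fromℕ (Σᶠ (weightAt M))
  seq-weight M n = trans
    (seq-foldr-+ _ f n (λ e → term (lookup M e) (exponent (remQuot 3 e))))
    (cong fromℕ (trans (Σᶠ-triples N f) (Σᶠ-cong λ j → cong₂ ℕ._+_ (at j zero) (cong₂ ℕ._+_ (at j (suc zero)) (at j (suc (suc zero)))))))
    where
    f : Vector ℕ ∣E∣
    f e = if lookup M e then 2 ℕ.^ exponent (remQuot 3 e) else 0
    term : ∀ b u → seq (if b then pw u else 0ℝ) n ≡ fromℕ (if b then 2 ℕ.^ u else 0)
    term true  u = refl
    term false u = refl
    at : ∀ j t → f (edge j t) ≡ (if lookup M (edge j t) then 2 ℕ.^ exponent (j , t) else 0)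
    at j t = cong (λ u → if lookup M (edge j t) then 2 ℕ.^ u else 0) (exponent-edge j t)
    Σᶠ-cong : ∀ {n} {f g : Vector ℕ n} → (∀ i → f i ≡ g i) → Σᶠ f ≡ Σᶠ g
    Σᶠ-cong {zero}  eq = refl
    Σᶠ-cong {suc n} eq = cong₂ ℕ._+_ (eq zero) (Σᶠ-cong (λ i → eq (suc i)))

  weight-mono : ∀ M M′ → (∀ j → weightAt M j ℕ.≤ weightAt M′ j) → weight M ≤ weight M′
  weight-mono M M′ h 0<ε = 0 , λ {n} _ → ℚₚ.≤-trans
    (subst₂ _≤ᵠ_ (sym (seq-weight M n)) (sym (seq-weight M′ n)) (fromℕ-mono (Σᶠ-mono h)))
    (p≤p+q (ℚₚ.<⇒≤ 0<ε))

  pick : (Fin N × Fin 3 → Bool) → Subset ∣E∣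
  pick s = Vec.tabulate (s ∘ remQuot 3)

  lookup-pick : ∀ s e → lookup (pick s) e ≡ s (remQuot 3 e)
  lookup-pick s = Vecₚ.lookup∘tabulate (s ∘ remQuot 3)

  lookup-pick-edge : ∀ s j t → lookup (pick s) (edge j t) ≡ s (j , t)
  lookup-pick-edge s j t = trans (lookup-pick s (edge j t)) (cong s (Finₚ.remQuot-combine j t))

  weightAt-pick : ∀ s j → weightAt (pick s) j ≡
    gadgetWeight (scale j) (s (j , zero)) (s (j , suc zero)) (s (j , suc (suc zero)))
  weightAt-pick s j
    rewrite lookup-pick-edge s j zero | lookup-pick-edge s j (suc zero) | lookup-pick-edge s j (suc (suc zero)) = refl

  pick-matching : ∀ s → (∀ j (t : Fin 2) → Exclusive (s (j , inject₁ t)) (s (j , suc t))) →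
                  IsMatching (pick s)
  pick-matching s ex = nonAdjacent⇒matching λ j t p q →
    ex j t (trans (sym (lookup-pick-edge s j (inject₁ t))) p) (trans (sym (lookup-pick-edge s j (suc t))) q)

  -- The two outer edges of every path form a matching, worth 3 * 2^u in a gadget of exponent u.
  μ⊤≥ : ∀ n → fromℕ (sum (List.map (λ u → 3 ℕ.* 2 ℕ.^ u) xs)) ≤ᵠ seq (μ ⊤) n
  μ⊤≥ n = ℚₚ.≤-trans
    (subst₂ _≤ᵠ_ (cong fromℕ (Σᶠ-lookup (λ u → 3 ℕ.* 2 ℕ.^ u) xs)) (sym (seq-weight (pick outer) n))
      (fromℕ-mono (Σᶠ-mono λ j → ℕₚ.≤-reflexive
        (sym (trans (weightAt-pick outer j) (gadgetWeight-101 (scale j)))))))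
    (weight≤μ ⊤ (pick outer) n (pick-matching outer ex , λ _ _ → Subsetₚ.∈⊤))
    where
    outer : Fin N × Fin 3 → Bool
    outer (j , suc zero) = false
    outer (j , _)        = true
    ex : ∀ j (t : Fin 2) → Exclusive (outer (j , inject₁ t)) (outer (j , suc t))
    ex j zero       p ()
    ex j (suc zero) ()

  -- Unfavourable maximum weight matchings of the classes.

  module Classes {k : ℕ} (κ : ℕ → Fin k) where

    -- A class boundary separates the two weights of a gadget of exponent u.
    split : ℕ → Bool
    split u = not (does (κ (suc u) Fin.≟ κ u))

    -- In a split gadget the two light edges tie, and the choice falls on the
    -- one adjacent to the heavy edge.
    chosen : Fin N × Fin 3 → Bool
    chosen (j , zero)           = true
    chosen (j , suc zero)       = split (σ j)
    chosen (j , suc (suc zero)) = not (split (σ j))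

    -- Membership is read off the labels `κ`, because comparing a real weight with the endpoints of
    -- a class is undecidable.
    inClass : Fin k → ℕ → Bool
    inClass i u = does (κ u Fin.≟ i)

    inClass⇒≡ : ∀ {i} u → inClass i u ≡ true → κ u ≡ i
    inClass⇒≡ {i} u eq with κ u Fin.≟ i | eq
    ... | yes p | _ = p

    same-class⇒¬split : ∀ {i} u → inClass i (suc u) ≡ true → inClass i u ≡ true → split u ≡ false
    same-class⇒¬split u p q = cong not (dec-true (κ (suc u) Fin.≟ κ u)
      (trans (inClass⇒≡ (suc u) p) (sym (inClass⇒≡ u q))))

    selected : Fin k → Fin N × Fin 3 → Bool
    selected i jt = inClass i (exponent jt) ∧ chosen jt

    M : Fin k → Subset ∣E∣
    M i = pick (selected i)

    ∧⁻ : ∀ {a b} → a ∧ b ≡ true → a ≡ true × b ≡ true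
    ∧⁻ {true} {true} refl = refl , refl

    not-exclusive : ∀ b → Exclusive b (not b)
    not-exclusive true  _ ()
    not-exclusive false ()

    -- If the heavy and the middle edge lie in one class, the gadget is not split and `chosen`
    -- rejects the middle edge; of the two light edges `chosen` always takes exactly one.
    M-matching : ∀ i → IsMatching (M i)
    M-matching i = pick-matching (selected i) ex
      where
      ex : ∀ j (t : Fin 2) → Exclusive (selected i (j , inject₁ t)) (selected i (j , suc t))
      ex j zero       p q = contradiction
        (trans (sym (proj₂ (∧⁻ {inClass i (σ j)} q)))
          (same-class⇒¬split (σ j) (proj₁ (∧⁻ p)) (proj₁ (∧⁻ q)))) λ ()
      ex j (suc zero) p q =
        not-exclusive (split (σ j)) (proj₂ (∧⁻ {inClass i (σ j)} p)) (proj₂ (∧⁻ {inClass i (σ j)} q))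

    M-class : ∀ i e → e ∈ M i → κ (exponent (remQuot 3 e)) ≡ i
    M-class i e e∈ = inClass⇒≡ _
      (proj₁ (∧⁻ (trans (sym (lookup-pick (selected i) e)) (∈⇒lookup e∈))))

    -- The weight is a sum over independent gadgets, so optimality is checked in each of them by
    -- `gadgetWeight-max`.
    M-max : ∀ i M′ → IsMatching M′ → (∀ e → e ∈ M′ → κ (exponent (remQuot 3 e)) ≡ i) →
            weight M′ ≤ weight (M i)
    M-max i M′ m M′-class = weight-mono M′ (M i) λ j →
      subst (weightAt M′ j ℕ.≤_) (sym (weightAt-pick (selected i) j))
        (gadgetWeight-max (scale j) (inClass i (suc (σ j))) (inClass i (σ j)) (split (σ j))
          (class j zero) (class j (suc zero)) (class j (suc (suc zero)))
          (na j zero) (na j (suc zero)) (same-class⇒¬split (σ j)))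
      where
      na : NonAdjacent M′
      na = matching⇒nonAdjacent m
      class : ∀ j t → lookup M′ (edge j t) ≡ true → inClass i (exponent (j , t)) ≡ true
      class j t eq = dec-true (κ (exponent (j , t)) Fin.≟ i)
        (trans (cong κ (sym (exponent-edge j t))) (M′-class (edge j t) (lookup⇒∈ eq)))

    -- `chosen` does not depend on the class, so an edge that it rejects is missing from every
    -- `M i`.
    split-lost : ∀ j → split (σ j) ≡ true → ¬ (edge j (suc (suc zero)) ∈ ⋃ (List.tabulate M))
    split-lost j sp e∈ =
      let i , e∈Mᵢ = ∈-⋃⁻ M e∈
          p = trans (sym (lookup-pick-edge (selected i) j (suc (suc zero)))) (∈⇒lookup e∈Mᵢ)
      in not-exclusive (split (σ j)) sp (proj₂ (∧⁻ {inClass i (σ j)} p))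

    value : ℕ → ℕ
    value u = if split u then 2 else 3

    -- A split gadget without its last edge consists of two adjacent edges, so a matching keeps at
    -- most 2 * 2^u there; elsewhere it keeps at most 3 * 2^u.
    μ⋃≤ : ∀ n → seq (μ (⋃ (List.tabulate M))) n ≤ᵠ fromℕ (sum (List.map (λ u → value u ℕ.* 2 ℕ.^ u) xs))
    μ⋃≤ n = μ≤ _ n (0≤fromℕ (sum (List.map (λ u → value u ℕ.* 2 ℕ.^ u) xs))) λ H (m , H⊆) → subst₂ _≤ᵠ_ (sym (seq-weight H n))
      (cong fromℕ (Σᶠ-lookup (λ u → value u ℕ.* 2 ℕ.^ u) xs))
      (fromℕ-mono (Σᶠ-mono λ j → bound H (matching⇒nonAdjacent m) H⊆ j (split (σ j)) refl))
      where
      bound : ∀ H → NonAdjacent H → (∀ e → e ∈ H → e ∈ ⋃ (List.tabulate M)) →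
              ∀ j b → split (σ j) ≡ b → weightAt H j ℕ.≤ (if b then 2 else 3) ℕ.* scale j
      bound H na H⊆ j false eq = gadgetWeight-≤3 (scale j) _ _ _ (na j zero) (na j (suc zero))
      bound H na H⊆ j true  eq
        rewrite ¬-not {lookup H (edge j (suc (suc zero)))} {true}
                  (λ c → split-lost j eq (H⊆ _ (lookup⇒∈ c)))
        = gadgetWeight-≤2 (scale j) _ _ (na j zero)

-- Scales of equal total weight.

-- Scale u occurs 2^(D-1-u) times, so that all scales u < D have equal total weight.
tree : ℕ → List ℕ
tree zero    = []
tree (suc D) = D ∷ tree D ++ tree D

tree< : ∀ D → All (ℕ._< D) (tree D)
tree< zero    = []
tree< (suc D) = ℕₚ.n<1+n D ∷ Allₚ.++⁺ h h
  where
  h : All (ℕ._< suc D) (tree D)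
  h = All.map ℕₚ.m<n⇒m<1+n (tree< D)

Σ< : ℕ → (ℕ → ℕ) → ℕ
Σ< zero    g = 0
Σ< (suc D) g = g D ℕ.+ Σ< D g

-- Scale u contributes g u * 2^(D-1) in total. Doubling both sides avoids the exponent D-1, so that
-- D = 0 is covered.
sum-tree : ∀ g D → 2 ℕ.* sum (List.map (λ u → g u ℕ.* 2 ℕ.^ u) (tree D)) ≡ 2 ℕ.^ D ℕ.* Σ< D g
sum-tree g zero    = refl
sum-tree g (suc D) = begin-equality
  2 ℕ.* (a ℕ.+ sum (List.map f (tree D ++ tree D)))
    ≡⟨ cong (λ s → 2 ℕ.* (a ℕ.+ s)) (trans (cong sum (map-++ f (tree D) (tree D)))
         (sum-++ (List.map f (tree D)) (List.map f (tree D)))) ⟩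
  2 ℕ.* (a ℕ.+ (s ℕ.+ s))
    ≡⟨ solve 2 (λ a s → con 2 :* (a :+ (s :+ s)) := con 2 :* a :+ con 2 :* (con 2 :* s)) refl a s ⟩
  2 ℕ.* a ℕ.+ 2 ℕ.* (2 ℕ.* s)
    ≡⟨ cong (λ z → 2 ℕ.* a ℕ.+ 2 ℕ.* z) (sum-tree g D) ⟩
  2 ℕ.* (g D ℕ.* 2 ℕ.^ D) ℕ.+ 2 ℕ.* (2 ℕ.^ D ℕ.* Σ< D g)
    ≡⟨ solve 3 (λ x p s → con 2 :* (x :* p) :+ con 2 :* (p :* s) := (con 2 :* p) :* (x :+ s))
         refl (g D) (2 ℕ.^ D) (Σ< D g) ⟩
  2 ℕ.^ suc D ℕ.* (g D ℕ.+ Σ< D g) ∎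
  where
  open ℕₚ.≤-Reasoning
  open ℕ-Solver.+-*-Solver
  f : ℕ → ℕ
  f u = g u ℕ.* 2 ℕ.^ u
  a s : ℕ
  a = f D
  s = sum (List.map f (tree D))

Σ<-const : ∀ b D → Σ< D (λ _ → b) ≡ D ℕ.* b
Σ<-const b zero    = refl
Σ<-const b (suc D) = cong (b ℕ.+_) (Σ<-const b D)

Σ<-≤ : ∀ {g b} D → (∀ u → g u ℕ.≤ b) → Σ< D g ℕ.≤ D ℕ.* b
Σ<-≤ zero    g≤b = ℕ.z≤n
Σ<-≤ (suc D) g≤b = ℕₚ.+-mono-≤ (g≤b D) (Σ<-≤ D g≤b)

Σ<-< : ∀ {g b u} D → (∀ u → g u ℕ.≤ b) → u ℕ.< D → g u ℕ.< b → Σ< D g ℕ.< D ℕ.* b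
Σ<-< {u = u} (suc D) g≤b u<D gu<b with ℕₚ.m≤n⇒m<n∨m≡n (ℕₚ.≤-pred u<D)
... | inj₁ u<D′ = ℕₚ.+-mono-≤-< (g≤b D) (Σ<-< D g≤b u<D′ gu<b)
... | inj₂ refl = ℕₚ.+-mono-<-≤ gu<b (Σ<-≤ D g≤b)

-- Order and disjointness of the weight classes.

≤-refl : ∀ x → x ≤ x
≤-refl x 0<ε = 0 , λ _ → p≤p+q (ℚₚ.<⇒≤ 0<ε)

first-least : ∀ {m} (ℓ r : Fin (suc m) → ℝ) → (∀ i → ℓ i ≤ r i) →
              (∀ i → ℓ (suc i) ≈ r (inject₁ i)) → ∀ j → ℓ zero ≤ ℓ j
first-least         ℓ r ℓ≤r cont zero    = ≤-refl (ℓ zero)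
first-least {suc m} ℓ r ℓ≤r cont (suc j) = ≤-trans (ℓ zero) (r zero) (ℓ (suc j)) (ℓ≤r zero)
  (≤-trans (r zero) (ℓ (suc zero)) (ℓ (suc j)) (proj₂ (cont zero))
    (first-least (λ i → ℓ (suc i)) (λ i → r (suc i)) (λ i → ℓ≤r (suc i)) (λ i → cont (suc i)) j))

ordered : ∀ {m} (ℓ r : Fin (suc m) → ℝ) → (∀ i → ℓ i ≤ r i) →
          (∀ i → ℓ (suc i) ≈ r (inject₁ i)) → ∀ {i j} → i Fin.< j → r i ≤ ℓ j
ordered {suc m} ℓ r ℓ≤r cont {zero}  {suc j} _ =
  ≤-trans (r zero) (ℓ (suc zero)) (ℓ (suc j)) (proj₂ (cont zero))
    (first-least (λ i → ℓ (suc i)) (λ i → r (suc i)) (λ i → ℓ≤r (suc i)) (λ i → cont (suc i)) j)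
ordered {suc m} ℓ r ℓ≤r cont {suc i} {suc j} (ℕ.s≤s i<j) =
  ordered (λ i → ℓ (suc i)) (λ i → r (suc i)) (λ i → ℓ≤r (suc i)) (λ i → cont (suc i)) i<j

module PartitionProperties {G : WeightedGraph} (P : WeightPartition G) where
  open WeightPartition P

  0<ℓ : ∀ i → 0ℝ < ℓ i
  0<ℓ i = <-≤-trans 0ℝ (ℓ zero) (ℓ i) 0<ℓ₁ (first-least ℓ r ℓ≤r contiguous i)

  -- Makes class labels unambiguous: membership of a real weight in two classes becomes an equality
  -- of indices.
  disjoint : ∀ {i j} x → [ ℓ i , r i ⟩ x → [ ℓ j , r j ⟩ x → i ≡ j
  disjoint {i} {j} x (ℓᵢ≤x , x<rᵢ) (ℓⱼ≤x , x<rⱼ) with Finₚ.<-cmp i j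
  ... | tri≈ _ i≡j _ = i≡j
  ... | tri< i<j _ _ = ⊥-elim (<-≤-absurd x (r i) x<rᵢ
          (≤-trans (r i) (ℓ j) x (ordered ℓ r ℓ≤r contiguous i<j) ℓⱼ≤x))
  ... | tri> _ _ j<i = ⊥-elim (<-≤-absurd x (r j) x<rⱼ
          (≤-trans (r j) (ℓ i) x (ordered ℓ r ℓ≤r contiguous j<i) ℓᵢ≤x))

-- Finite choice and search without decidability.

-- The goal is a negation, so the n + 1 double negations can be eliminated one inside the other.
¬¬-choice : ∀ {A : Set} n {Q : ℕ → A → Set} → (∀ u → u ℕ.≤ n → ¬ ¬ (∃[ a ] Q u a)) →
            ¬ ¬ (Σ[ κ ∈ (ℕ → A) ] (∀ u → u ℕ.≤ n → Q u (κ u)))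
-- Arguments beyond the bound are unconstrained, so the constant function provides default values.
¬¬-choice zero    h ¬κ = h 0 ℕ.z≤n λ { (a , q) → ¬κ ((λ _ → a) , λ { zero ℕ.z≤n → q }) }
¬¬-choice {A} (suc n) {Q} h ¬κ = h 0 ℕ.z≤n λ { (a , q) →
  ¬¬-choice n (λ u u≤n → h (suc u) (ℕ.s≤s u≤n)) λ { (κ , κ-ok) →
    ¬κ (extend a κ , λ { zero _ → q ; (suc u) (ℕ.s≤s u≤n) → κ-ok u u≤n }) } }
  where
  extend : A → (ℕ → A) → ℕ → A
  extend a κ zero    = a
  extend a κ (suc u) = κ u

change-or-constant : ∀ {k} (κ : ℕ → Fin k) n →
                     (∃[ u ] u ℕ.< n × κ (suc u) ≢ κ u) ⊎ κ n ≡ κ 0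
change-or-constant κ zero = inj₂ refl
change-or-constant κ (suc n) with change-or-constant κ n | κ (suc n) Fin.≟ κ n
... | inj₁ (u , u<n , κ≢) | _     = inj₁ (u , ℕₚ.m<n⇒m<1+n u<n , κ≢)
... | inj₂ _             | no κ≢  = inj₁ (n , ℕₚ.n<1+n n , κ≢)
... | inj₂ κn≡κ0         | yes p = inj₂ (trans p κn≡κ0)

-- Meant for the alternatives of `cotransitive`, which may overlap and need not be decidable.
search-⊎ : ∀ {n} {P Q : Fin n → Set} → (∀ i → P i ⊎ Q i) → (∃[ i ] P i) ⊎ (∀ i → Q i)
search-⊎ {zero}  h = inj₂ λ ()
search-⊎ {suc n} h with h zero | search-⊎ (λ i → h (suc i))
... | inj₁ p | _            = inj₁ (zero , p)
... | inj₂ q | inj₁ (i , p) = inj₁ (suc i , p)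
... | inj₂ q | inj₂ qs      = inj₂ λ { zero → q ; (suc i) → qs i }

-- Constants, the number of scales and numerical estimates.

1≤fromℕ-2^ : ∀ m → 1ℚ ≤ᵠ fromℕ (2 ℕ.^ m)
1≤fromℕ-2^ m = fromℕ-mono {1} (ℕₚ.m^n>0 2 m)

-- Doubling adds x * 2^m ≥ x ≥ ε, so the ε that witnesses 0 < x is also the gap.
scale-< : ∀ x m → 0ℝ < x → x * pw m < x * pw (suc m)
scale-< x m (ε , 0<ε , N , ε≤x) = ε , 0<ε , N , λ {n} N≤n → begin
  seq x n *ᵠ p +ᵠ ε
    ≤⟨ ℚₚ.+-monoʳ-≤ (seq x n *ᵠ p) (ε≤xp n (subst (_≤ᵠ seq x n) (ℚₚ.+-identityˡ ε) (ε≤x N≤n))) ⟩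
  seq x n *ᵠ p +ᵠ seq x n *ᵠ p
    ≡⟨ solve 2 (λ x p → x :* p :+ x :* p := x :* (con (fromℕ 2) :* p)) refl (seq x n) p ⟩
  seq x n *ᵠ (fromℕ 2 *ᵠ p)
    ≡⟨ cong (seq x n *ᵠ_) (fromℕ-* 2 (2 ℕ.^ m)) ⟨
  seq x n *ᵠ fromℕ (2 ℕ.^ suc m) ∎
  where
  open ℚₚ.≤-Reasoning
  open ℚ-Solver.+-*-Solver
  p : ℚ
  p = fromℕ (2 ℕ.^ m)
  ε≤xp : ∀ n → ε ≤ᵠ seq x n → ε ≤ᵠ seq x n *ᵠ p
  ε≤xp n ε≤ = subst (_≤ᵠ seq x n *ᵠ p) (ℚₚ.*-identityʳ ε)
    (*-mono (ℚₚ.<⇒≤ 0<ε) (0≤fromℕ (2 ℕ.^ m)) ε≤ (1≤fromℕ-2^ m))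

*-≤1 : ∀ x {q} → 0ℚ ≤ᵠ q → x ≤ 1ℝ → x * fromℚ q ≤ fromℚ q
*-≤1 x {q} 0≤q x≤1 {ε} 0<ε =
  let η , 0<η , qη≤ε = shrink q ε 0≤q 0<ε
  in eventually-map (λ {n} x≤ → begin
       seq x n *ᵠ q     ≤⟨ *-monoʳ 0≤q x≤ ⟩
       (1ℚ +ᵠ η) *ᵠ q   ≡⟨ solve 2 (λ η q → (con 1ℚ :+ η) :* q := q :+ q :* η) refl η q ⟩
       q +ᵠ q *ᵠ η      ≤⟨ ℚₚ.+-monoʳ-≤ q qη≤ε ⟩
       q +ᵠ ε           ∎) (x≤1 0<η)
  where
  open ℚₚ.≤-Reasoning
  open ℚ-Solver.+-*-Solver

-- δ ≤ 1/24 with tolerance 1/24 bounds an approximation q of δ by 1/12; with d = q/2 this gives 2 *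
-- 12d ≤ 1, room for two scales. The value 1/72 makes 12 * c₀ = 1/6, as `c/d≤` requires.
c₀ δ₁ : ℚ
c₀ = ℤ.+ 1 Rat./ 72
δ₁ = ℤ.+ 1 Rat./ 24

-- 3Lδ ≤ ¾, so that 1/(3L) exceeds δ by a definite factor.
Small : ℕ → ℝ → Set
Small L δ = Eventually (λ n → 0ℚ ≤ᵠ 1ℚ -ᵠ seq δ n × seq δ n *ᵠ fromℕ (L ℕ.* 3) ≤ᵠ ℤ.+ 3 Rat./ 4)

-- A rational d with d ≤ δ ≤ 3d, and a number m + 2 of scales comparable to 1/d.
record Parameters (δ : ℝ) : Set where
  field
    d      : ℚ
    0<d    : 0ℚ <ᵠ d
    bounds : Eventually (λ n → d ≤ᵠ seq δ n × seq δ n ≤ᵠ fromℕ 3 *ᵠ d)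
    m      : ℕ
    lower  : fromℕ (2 ℕ.+ m) *ᵠ (fromℕ 12 *ᵠ d) ≤ᵠ 1ℚ
    upper  : 1ℚ ≤ᵠ fromℕ (3 ℕ.+ m) *ᵠ (fromℕ 12 *ᵠ d)

-- A descent from a large M finds m + 2, the integer part of 1/D up to ties; the hypothesis on 2D
-- settles the bottom.
last-below-1 : ∀ {D} → 0ℚ ≤ᵠ D → fromℕ 2 *ᵠ D ≤ᵠ 1ℚ → ∀ M → 1ℚ ≤ᵠ fromℕ (2 ℕ.+ M) *ᵠ D →
               ∃[ m ] fromℕ (2 ℕ.+ m) *ᵠ D ≤ᵠ 1ℚ × 1ℚ ≤ᵠ fromℕ (3 ℕ.+ m) *ᵠ D
last-below-1 0≤D 2D≤1 zero    1≤ =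
  0 , 2D≤1 , ℚₚ.≤-trans 1≤ (*-monoʳ 0≤D (fromℕ-mono {2} {3} (ℕₚ.n≤1+n 2)))
last-below-1 {D} 0≤D 2D≤1 (suc M) 1≤ with ℚₚ.≤-total (fromℕ (2 ℕ.+ M) *ᵠ D) 1ℚ
... | inj₁ ≤1  = M , ≤1 , 1≤
... | inj₂ 1≤′ = last-below-1 0≤D 2D≤1 M 1≤′

abstract
  parameters : ∀ δ → 0ℝ < δ → δ ≤ fromℚ δ₁ → Parameters δ
  parameters δ (ε , 0<ε , N₀ , ε≤δ) δ≤δ₁ = build (halve ε 0<ε)
    where
    open ℚₚ.≤-Reasoning
    open ℚ-Solver.+-*-Solver
    0<δ₁ : 0ℚ <ᵠ δ₁
    0<δ₁ = ℚₚ.positive⁻¹ δ₁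
    N₂ : ℕ
    N₂ = proj₁ (δ≤δ₁ 0<δ₁)
    build : ∃[ η ] 0ℚ <ᵠ η × (1ℚ +ᵠ 1ℚ) *ᵠ η ≤ᵠ ε → Parameters δ
    build (η , 0<η , 2η≤ε) = record
      { d = d ; 0<d = 0<d ; bounds = N , (λ N≤n → d≤ N≤n , ≤3d N≤n)
      ; m = proj₁ found ; lower = proj₁ (proj₂ found) ; upper = proj₂ (proj₂ found) }
      where
      N₁ N : ℕ
      N₁ = proj₁ (cauchy δ 0<η)
      N  = N₀ ℕ.⊔ (N₁ ℕ.⊔ N₂)
      N₁≤ : ∀ {n} → N ℕ.≤ n → N₁ ℕ.≤ n
      N₁≤ h = ℕₚ.m⊔n≤o⇒m≤o N₁ N₂ (ℕₚ.m⊔n≤o⇒n≤o N₀ (N₁ ℕ.⊔ N₂) h)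
      q d D : ℚ
      q = seq δ N
      -- From 2η ≤ ε ≤ q follows η ≤ d, so later terms of δ lie within d of q = 2d, between d and
      -- 3d.
      d = ½ *ᵠ q
      D = fromℕ 12 *ᵠ d
      q≡2d : q ≡ (1ℚ +ᵠ 1ℚ) *ᵠ d
      q≡2d = solve 1 (λ q → q := (con 1ℚ :+ con 1ℚ) :* (con ½ :* q)) refl q
      η≤d : η ≤ᵠ d
      η≤d = cancel-suc 1 (begin
        fromℕ 2 *ᵠ η   ≤⟨ 2η≤ε ⟩
        ε              ≤⟨ subst (_≤ᵠ q) (ℚₚ.+-identityˡ ε) (ε≤δ (ℕₚ.m⊔n≤o⇒m≤o N₀ (N₁ ℕ.⊔ N₂) ℕₚ.≤-refl)) ⟩
        q              ≡⟨ q≡2d ⟩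
        fromℕ 2 *ᵠ d   ∎)
      0<d : 0ℚ <ᵠ d
      0<d = ℚₚ.<-≤-trans 0<η η≤d
      ≤3d : ∀ {n} → N ℕ.≤ n → seq δ n ≤ᵠ fromℕ 3 *ᵠ d
      ≤3d {n} N≤n = begin
        seq δ n                ≤⟨ ∣-∣-≤⇒≤+ (seq δ n) q (proj₂ (cauchy δ 0<η) (N₁≤ N≤n) (N₁≤ ℕₚ.≤-refl)) ⟩
        q +ᵠ η                 ≤⟨ ℚₚ.+-mono-≤ (ℚₚ.≤-reflexive q≡2d) η≤d ⟩
        (1ℚ +ᵠ 1ℚ) *ᵠ d +ᵠ d   ≡⟨ solve 1 (λ d → (con 1ℚ :+ con 1ℚ) :* d :+ d := con (fromℕ 3) :* d) refl d ⟩
        fromℕ 3 *ᵠ d           ∎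
      d≤ : ∀ {n} → N ℕ.≤ n → d ≤ᵠ seq δ n
      d≤ {n} N≤n = begin
        d                        ≡⟨ solve 1 (λ d → d := (con 1ℚ :+ con 1ℚ) :* d :- d) refl d ⟩
        (1ℚ +ᵠ 1ℚ) *ᵠ d -ᵠ d     ≡⟨ cong (_-ᵠ d) q≡2d ⟨
        q -ᵠ d                   ≤⟨ ≤+⇒-≤ (begin
          q                        ≤⟨ ∣-∣-≤⇒≤+ q (seq δ n) (proj₂ (cauchy δ 0<η) (N₁≤ ℕₚ.≤-refl) (N₁≤ N≤n)) ⟩
          seq δ n +ᵠ η             ≤⟨ ℚₚ.+-monoʳ-≤ (seq δ n) η≤d ⟩
          seq δ n +ᵠ d             ≡⟨ ℚₚ.+-comm (seq δ n) d ⟩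
          d +ᵠ seq δ n             ∎) ⟩
        seq δ n                  ∎
      0<D : 0ℚ <ᵠ D
      0<D = 0<* (0<fromℕ-suc 11) 0<d
      2D≤1 : fromℕ 2 *ᵠ D ≤ᵠ 1ℚ
      2D≤1 = begin
        fromℕ 2 *ᵠ D             ≡⟨ solve 1 (λ q → con (fromℕ 2) :* (con (fromℕ 12) :* (con ½ :* q)) :=
                                       con (fromℕ 12) :* q) refl q ⟩
        fromℕ 12 *ᵠ q            ≤⟨ *-monoˡ (0≤fromℕ 12) (proj₂ (δ≤δ₁ 0<δ₁)
                                     (ℕₚ.m⊔n≤o⇒n≤o N₁ N₂ (ℕₚ.m⊔n≤o⇒n≤o N₀ (N₁ ℕ.⊔ N₂) ℕₚ.≤-refl))) ⟩
        fromℕ 12 *ᵠ (δ₁ +ᵠ δ₁)   ≡⟨⟩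
        1ℚ                       ∎
      found : ∃[ m ] fromℕ (2 ℕ.+ m) *ᵠ D ≤ᵠ 1ℚ × 1ℚ ≤ᵠ fromℕ (3 ℕ.+ m) *ᵠ D
      found =
        let M , 1≤MD = archimedean 1ℚ 0<D
        in last-below-1 (ℚₚ.<⇒≤ 0<D) 2D≤1 M
             (ℚₚ.≤-trans 1≤MD (*-monoʳ (ℚₚ.<⇒≤ 0<D) (fromℕ-mono (ℕₚ.m≤n+m M 2))))

module Bounds {δ : ℝ} (Π : Parameters δ) where
  open Parameters Π
  open ℚₚ.≤-Reasoning
  open ℚ-Solver.+-*-Solver

  -- `upper` gives 1/d ≤ 12 * (3 + m), hence c₀/d ≤ (3 + m)/6, and 3 + m ≤ 3 * (1 + m).
  c/d≤ : c₀ *ᵠ recip d ≤ᵠ fromℕ (1 ℕ.+ m) *ᵠ ½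
  c/d≤ = begin
    c₀ *ᵠ recip d
      ≡⟨ cong (c₀ *ᵠ_) (ℚₚ.*-identityˡ (recip d)) ⟨
    c₀ *ᵠ (1ℚ *ᵠ recip d)
      ≤⟨ *-monoˡ (ℚₚ.nonNegative⁻¹ c₀) (*-monoʳ (recip-pos 0<d) upper) ⟩
    c₀ *ᵠ ((fromℕ (3 ℕ.+ m) *ᵠ (fromℕ 12 *ᵠ d)) *ᵠ recip d)
      ≡⟨ solve 4 (λ c x d i → c :* ((x :* (con (fromℕ 12) :* d)) :* i) :=
           (c :* con (fromℕ 12)) :* x :* (d :* i)) refl c₀ (fromℕ (3 ℕ.+ m)) d (recip d) ⟩
    (c₀ *ᵠ fromℕ 12) *ᵠ fromℕ (3 ℕ.+ m) *ᵠ (d *ᵠ recip d)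
      ≡⟨ trans (cong ((c₀ *ᵠ fromℕ 12) *ᵠ fromℕ (3 ℕ.+ m) *ᵠ_) (recip-inverse 0<d)) (ℚₚ.*-identityʳ _) ⟩
    (c₀ *ᵠ fromℕ 12) *ᵠ fromℕ (3 ℕ.+ m)
      ≤⟨ *-monoˡ (ℚₚ.nonNegative⁻¹ (c₀ *ᵠ fromℕ 12)) (fromℕ-mono {3 ℕ.+ m} {3 ℕ.* (1 ℕ.+ m)}
           (ℕₚ.≤-trans (ℕₚ.+-monoʳ-≤ 3 (ℕₚ.m≤n*m m 3)) (ℕₚ.≤-reflexive (sym (ℕₚ.*-suc 3 m))))) ⟩
    (c₀ *ᵠ fromℕ 12) *ᵠ fromℕ (3 ℕ.* (1 ℕ.+ m))
      ≡⟨ cong ((c₀ *ᵠ fromℕ 12) *ᵠ_) (fromℕ-* 3 (1 ℕ.+ m)) ⟩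
    (c₀ *ᵠ fromℕ 12) *ᵠ (fromℕ 3 *ᵠ fromℕ (1 ℕ.+ m))
      ≡⟨ solve 1 (λ x → con (c₀ *ᵠ fromℕ 12) :* (con (fromℕ 3) :* x) := x :* con ½) refl (fromℕ (1 ℕ.+ m)) ⟩
    fromℕ (1 ℕ.+ m) *ᵠ ½ ∎

  L : ℕ
  L = 2 ℕ.+ m

  -- The exponent is at most (1 + m)/2, so the exponential is at most 2^(1 + m). This is one factor
  -- 2 below 2^L, and the spare factor supplies the strict gap that `cotransitive` needs.
  exp-< : ∀ x {{0<δ : 0ℝ < δ}} → 0ℝ < x → x * exp (fromℚ c₀ * δ ⁻¹) < x * pw L
  exp-< x 0<x@(ε , 0<ε , ε≤x) = ε , 0<ε ,
    eventually-map (λ {n} (ε≤ , (d≤δ , _) , gap) → ℚₚ.≤-trans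
      (ℚₚ.+-monoˡ-≤ ε (*-monoˡ (ℚₚ.≤-trans (ℚₚ.<⇒≤ 0<ε) (subst (_≤ᵠ seq x n) (ℚₚ.+-identityˡ ε) ε≤))
        (ℚₚ.≤-trans
          (expSum-mono (0≤* (ℚₚ.nonNegative⁻¹ c₀) (recip-pos (ℚₚ.<-≤-trans 0<d d≤δ)))
            (ℚₚ.≤-trans (*-monoˡ (ℚₚ.nonNegative⁻¹ c₀) (recip-anti 0<d d≤δ)) c/d≤) n)
          (expSum-≤-2^ (1 ℕ.+ m) n))))
      gap)
    (eventually-× ε≤x (eventually-× bounds (proj₂ (proj₂ (scale-< x (1 ℕ.+ m) 0<x)))))

  -- Since δ ≤ 3d and 12Ld ≤ 1, the product 3Lδ is at most 9Ld ≤ 9/12.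
  3Lδ≤¾ : ∀ {δₙ} → δₙ ≤ᵠ fromℕ 3 *ᵠ d → δₙ *ᵠ fromℕ (L ℕ.* 3) ≤ᵠ ℤ.+ 3 Rat./ 4
  3Lδ≤¾ {δₙ} δₙ≤ = begin
    δₙ *ᵠ fromℕ (L ℕ.* 3)                  ≤⟨ *-monoʳ (0≤fromℕ (L ℕ.* 3)) δₙ≤ ⟩
    (fromℕ 3 *ᵠ d) *ᵠ fromℕ (L ℕ.* 3)      ≡⟨ cong ((fromℕ 3 *ᵠ d) *ᵠ_) (fromℕ-* L 3) ⟩
    (fromℕ 3 *ᵠ d) *ᵠ (fromℕ L *ᵠ fromℕ 3) ≡⟨ solve 2 (λ d l → (con (fromℕ 3) :* d) :* (l :* con (fromℕ 3)) :=
                                               con (ℤ.+ 3 Rat./ 4) :* (l :* (con (fromℕ 12) :* d)))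
                                               refl d (fromℕ L) ⟩
    (ℤ.+ 3 Rat./ 4) *ᵠ (fromℕ L *ᵠ (fromℕ 12 *ᵠ d))
                                           ≤⟨ *-monoˡ (ℚₚ.nonNegative⁻¹ (ℤ.+ 3 Rat./ 4)) lower ⟩
    (ℤ.+ 3 Rat./ 4) *ᵠ 1ℚ                  ≡⟨⟩
    ℤ.+ 3 Rat./ 4                          ∎

  1≤3L : 1ℚ ≤ᵠ fromℕ (L ℕ.* 3)
  1≤3L = fromℕ-mono {1} {L ℕ.* 3} (ℕ.s≤s ℕ.z≤n)

  small : Small L δ
  small = eventually-map (λ {n} (d≤δ , δ≤3d) → 0≤1-δ {seq δ n} (ℚₚ.≤-trans (ℚₚ.<⇒≤ 0<d) d≤δ) (3Lδ≤¾ {seq δ n} δ≤3d) , 3Lδ≤¾ {seq δ n} δ≤3d) bounds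
    where
    0≤1-δ : ∀ {δₙ} → 0ℚ ≤ᵠ δₙ → δₙ *ᵠ fromℕ (L ℕ.* 3) ≤ᵠ ℤ.+ 3 Rat./ 4 → 0ℚ ≤ᵠ 1ℚ -ᵠ δₙ
    0≤1-δ {δₙ} 0≤δₙ 3Lδₙ≤¾ = begin
      0ℚ            ≡⟨ ℚₚ.+-inverseʳ δₙ ⟨
      δₙ -ᵠ δₙ      ≤⟨ ℚₚ.+-monoˡ-≤ (-ᵠ δₙ) (begin
        δₙ                       ≡⟨ ℚₚ.*-identityʳ δₙ ⟨
        δₙ *ᵠ 1ℚ                 ≤⟨ *-monoˡ 0≤δₙ 1≤3L ⟩
        δₙ *ᵠ fromℕ (L ℕ.* 3)    ≤⟨ 3Lδₙ≤¾ ⟩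
        ℤ.+ 3 Rat./ 4            ≤⟨ from-yes ((ℤ.+ 3 Rat./ 4) ℚₚ.≤? 1ℚ) ⟩
        1ℚ                       ∎) ⟩
      1ℚ -ᵠ δₙ      ∎

-- Used with P = 2^L, so that the light edges of each scale have total weight P / 2:
-- the optimum is a = w P / 2 with w = 3L, and one separated scale costs P / 2.
loss-absurd : ∀ {t w P a b μ₁ μ₂} → 0ℚ ≤ᵠ 1ℚ -ᵠ t → t *ᵠ w ≤ᵠ ℤ.+ 3 Rat./ 4 → 1ℚ ≤ᵠ P →
              fromℕ 2 *ᵠ a ≡ P *ᵠ w → fromℕ 2 *ᵠ b +ᵠ P ≤ᵠ P *ᵠ w →
              a ≤ᵠ μ₁ → μ₂ ≤ᵠ b → (1ℚ -ᵠ t) *ᵠ μ₁ ≤ᵠ μ₂ +ᵠ ℤ.+ 1 Rat./ 16 → ⊥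
loss-absurd {t} {w} {P} {a} {b} {μ₁} {μ₂} 0≤1-t tw≤¾ 1≤P 2a≡ 2b≤ a≤μ₁ μ₂≤b h =
  -- The factor 1 - t excuses a loss of at most ¾ P in doubled weights, while P is lost. The
  -- remaining P/4 ≥ 1/4 exceeds the doubled tolerance 2/16.
  contradiction ¼≤⅛ (from-no ((ℤ.+ 1 Rat./ 4) ℚₚ.≤? (ℤ.+ 1 Rat./ 8)))
  where
  open ℚₚ.≤-Reasoning
  open ℚ-Solver.+-*-Solver
  2b+P≤ : fromℕ 2 *ᵠ b +ᵠ P ≤ᵠ (fromℕ 2 *ᵠ b +ᵠ P *ᵠ (ℤ.+ 3 Rat./ 4)) +ᵠ (ℤ.+ 1 Rat./ 8)
  2b+P≤ = begin
    fromℕ 2 *ᵠ b +ᵠ P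
      ≤⟨ 2b≤ ⟩
    P *ᵠ w
      ≡⟨ solve 3 (λ P w t → P :* w := (con 1ℚ :- t) :* (P :* w) :+ P :* (t :* w)) refl P w t ⟩
    (1ℚ -ᵠ t) *ᵠ (P *ᵠ w) +ᵠ P *ᵠ (t *ᵠ w)
      ≡⟨ cong (λ z → (1ℚ -ᵠ t) *ᵠ z +ᵠ P *ᵠ (t *ᵠ w)) 2a≡ ⟨
    (1ℚ -ᵠ t) *ᵠ (fromℕ 2 *ᵠ a) +ᵠ P *ᵠ (t *ᵠ w)
      ≡⟨ cong (_+ᵠ P *ᵠ (t *ᵠ w)) (solve 2 (λ s a → s :* (con (fromℕ 2) :* a) := con (fromℕ 2) :* (s :* a))
           refl (1ℚ -ᵠ t) a) ⟩
    fromℕ 2 *ᵠ ((1ℚ -ᵠ t) *ᵠ a) +ᵠ P *ᵠ (t *ᵠ w)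
      ≤⟨ ℚₚ.+-mono-≤
           (*-monoˡ (0≤fromℕ 2) (ℚₚ.≤-trans (*-monoˡ 0≤1-t a≤μ₁)
             (ℚₚ.≤-trans h (ℚₚ.+-monoˡ-≤ (ℤ.+ 1 Rat./ 16) μ₂≤b))))
           (*-monoˡ (ℚₚ.≤-trans 0≤1 1≤P) tw≤¾) ⟩
    fromℕ 2 *ᵠ (b +ᵠ ℤ.+ 1 Rat./ 16) +ᵠ P *ᵠ (ℤ.+ 3 Rat./ 4)
      ≡⟨ solve 2 (λ b P → con (fromℕ 2) :* (b :+ con (ℤ.+ 1 Rat./ 16)) :+ P :* con (ℤ.+ 3 Rat./ 4) :=
           (con (fromℕ 2) :* b :+ P :* con (ℤ.+ 3 Rat./ 4)) :+ con (ℤ.+ 1 Rat./ 8)) refl b P ⟩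
    (fromℕ 2 *ᵠ b +ᵠ P *ᵠ (ℤ.+ 3 Rat./ 4)) +ᵠ (ℤ.+ 1 Rat./ 8) ∎
  ¼≤⅛ : ℤ.+ 1 Rat./ 4 ≤ᵠ ℤ.+ 1 Rat./ 8
  ¼≤⅛ = begin
    ℤ.+ 1 Rat./ 4
      ≤⟨ *-monoˡ (ℚₚ.nonNegative⁻¹ (ℤ.+ 1 Rat./ 4)) 1≤P ⟩
    (ℤ.+ 1 Rat./ 4) *ᵠ P
      ≡⟨ solve 2 (λ b P → con (ℤ.+ 1 Rat./ 4) :* P :=
           (con (fromℕ 2) :* b :+ P) :- (con (fromℕ 2) :* b :+ P :* con (ℤ.+ 3 Rat./ 4))) refl b P ⟩
    (fromℕ 2 *ᵠ b +ᵠ P) -ᵠ (fromℕ 2 *ᵠ b +ᵠ P *ᵠ (ℤ.+ 3 Rat./ 4))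
      ≤⟨ ≤+⇒-≤ 2b+P≤ ⟩
    ℤ.+ 1 Rat./ 8 ∎

-- Existence of a wide class.

Preserving : ℝ → ∀ {G} → WeightPartition G → Set
Preserving δ {G} P =
  let open WeightedGraph G
      open Matching G
      open WeightPartition P
  in ∀ (M : Fin k → Subset ∣E∣) →
       (∀ i → IsMaxWeightMatchingOf (class i) (M i)) →
       (1ℝ - δ) * μ ⊤ ≤ μ (⋃ (tabulate M))

HasWideClass : ℝ → ∀ {G} → WeightPartition G → Set
HasWideClass x P = ∃[ i ] ℓ i * exp x ≤ r i
  where open WeightPartition P

module LowerBound (L : ℕ) where
  open GadgetGraph L (tree L) (tree< L)
  open WeightedGraph G using (∣E∣)
  open Matching G

  module _ {k : ℕ} (κ : ℕ → Fin k) where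
    open Classes κ

    S₃ Sᵥ : ℕ
    S₃ = sum (List.map (λ u → 3 ℕ.* 2 ℕ.^ u) (tree L))
    Sᵥ = sum (List.map (λ u → value u ℕ.* 2 ℕ.^ u) (tree L))

    value≤3 : ∀ u → value u ℕ.≤ 3
    value≤3 u with split u
    ... | true  = ℕₚ.n≤1+n 2
    ... | false = ℕₚ.≤-refl

    value<3 : ∀ {u} → κ (suc u) ≢ κ u → value u ℕ.< 3
    value<3 {u} κ≢ = ℕₚ.≤-reflexive
      (cong (λ b → suc (if not b then 2 else 3)) (dec-false (κ (suc u) Fin.≟ κ u) κ≢))

    2S₃≡ : fromℕ 2 *ᵠ fromℕ S₃ ≡ fromℕ (2 ℕ.^ L) *ᵠ fromℕ (L ℕ.* 3)
    2S₃≡ = trans (sym (fromℕ-* 2 S₃)) (trans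
      (cong fromℕ (trans (sum-tree (λ _ → 3) L) (cong (2 ℕ.^ L ℕ.*_) (Σ<-const 3 L))))
      (fromℕ-* (2 ℕ.^ L) (L ℕ.* 3)))

    -- A split scale lowers the sum of the values by at least 1, which `sum-tree` magnifies to 2^L.
    2Sᵥ≤ : ∀ {u} → u ℕ.< L → κ (suc u) ≢ κ u →
           fromℕ 2 *ᵠ fromℕ Sᵥ +ᵠ fromℕ (2 ℕ.^ L) ≤ᵠ fromℕ (2 ℕ.^ L) *ᵠ fromℕ (L ℕ.* 3)
    2Sᵥ≤ {u} u<L κ≢ = subst₂ _≤ᵠ_
      (trans (fromℕ-+ (2 ℕ.* Sᵥ) (2 ℕ.^ L)) (cong (_+ᵠ fromℕ (2 ℕ.^ L)) (fromℕ-* 2 Sᵥ)))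
      (fromℕ-* (2 ℕ.^ L) (L ℕ.* 3))
      (fromℕ-mono (begin
        2 ℕ.* Sᵥ ℕ.+ 2 ℕ.^ L                   ≡⟨ cong (ℕ._+ 2 ℕ.^ L) (sum-tree value L) ⟩
        2 ℕ.^ L ℕ.* Σ< L value ℕ.+ 2 ℕ.^ L     ≡⟨ ℕₚ.+-comm (2 ℕ.^ L ℕ.* Σ< L value) (2 ℕ.^ L) ⟩
        2 ℕ.^ L ℕ.+ 2 ℕ.^ L ℕ.* Σ< L value     ≡⟨ ℕₚ.*-suc (2 ℕ.^ L) (Σ< L value) ⟨
        2 ℕ.^ L ℕ.* suc (Σ< L value)           ≤⟨ ℕₚ.*-monoʳ-≤ (2 ℕ.^ L) (Σ<-< L value≤3 u<L (value<3 κ≢)) ⟩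
        2 ℕ.^ L ℕ.* (L ℕ.* 3)                  ∎))
      where open ℕₚ.≤-Reasoning

    split-absurd : ∀ {δ u} → u ℕ.< L → κ (suc u) ≢ κ u →
      Small L δ →
      (1ℝ - δ) * μ ⊤ ≤ μ (⋃ (tabulate M)) → ⊥
    split-absurd {δ} u<L κ≢ small kept =
      let n , h = eventually-× small (kept (ℚₚ.positive⁻¹ (ℤ.+ 1 Rat./ 16)))
          (0≤1-δ , 3Lδ≤¾) , keptₙ = h ℕₚ.≤-refl
      in loss-absurd {seq δ n} {fromℕ (L ℕ.* 3)} {fromℕ (2 ℕ.^ L)} {fromℕ S₃} {fromℕ Sᵥ} 0≤1-δ 3Lδ≤¾ (1≤fromℕ-2^ L) 2S₃≡ (2Sᵥ≤ u<L κ≢) (μ⊤≥ n) (μ⋃≤ n) keptₙ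

  module _ (P : WeightPartition G) where
    open WeightPartition P
    open PartitionProperties P

    module _ (κ : ℕ → Fin k) (κ-class : ∀ u → u ℕ.≤ L → [ ℓ (κ u) , r (κ u) ⟩ (pw u)) where
      open Classes κ

      -- `κ-class` turns labels into membership of real weights, and `disjoint` turns membership
      -- back into labels.
      M-maximum : ∀ i → IsMaxWeightMatchingOf (class i) (M i)
      M-maximum i =
        (M-matching i , λ e e∈ → subst (λ j → [ ℓ j , r j ⟩ (pw (u e))) (M-class i e e∈) (in-class e)) ,
        λ M′ (m , M′-class) → M-max i M′ m λ e e∈ → disjoint (pw (u e)) (in-class e) (M′-class e e∈)
        where
        u : Fin ∣E∣ → ℕ
        u e = exponent (remQuot 3 e)
        in-class : ∀ e → [ ℓ (κ (u e)) , r (κ (u e)) ⟩ (pw (u e))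
        in-class e = κ-class (u e) (exponent≤L (remQuot 3 e))

      -- If 1 and 2^L share a class, then ℓ ≤ 1 and 2^L < r, against r ≤ ℓ * 2^L ≤ 2^L.
      constant-absurd : κ L ≡ κ 0 → (∀ i → r i ≤ ℓ i * pw L) → ⊥
      constant-absurd κL≡κ0 r≤ = <-≤-absurd (pw L) (r (κ 0))
        (subst (λ i → pw L < r i) κL≡κ0 (proj₂ (κ-class L ℕₚ.≤-refl)))
        (≤-trans (r (κ 0)) (ℓ (κ 0) * pw L) (pw L) (r≤ (κ 0))
          (*-≤1 (ℓ (κ 0)) (0≤fromℕ (2 ℕ.^ L)) (proj₁ (κ-class 0 ℕ.z≤n))))

    -- As the goal is ⊥, labels may be extracted from the doubly negated `covers`. Either two
    -- consecutive scales have different labels and too much weight is lost, or 1 and 2^L share a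
    -- class.
    narrow-absurd : ∀ {δ} →
      Small L δ →
      Preserving δ P → (∀ i → r i ≤ ℓ i * pw L) → ⊥
    narrow-absurd {δ} small preserving r≤ = ¬¬-choice L
      (λ u u≤L → covers (pw u) (pw-mono {0} {u} ℕ.z≤n) (pw-mono u≤L))
      λ { (κ , κ-class) →
        [ (λ { (u , u<L , κ≢) → split-absurd κ {δ} u<L κ≢ small
                 (preserving (Classes.M κ) (M-maximum κ κ-class)) })
        , (λ κL≡κ0 → constant-absurd κ κ-class κL≡κ0 r≤) ]′ (change-or-constant κ L) }

    wide-class : ∀ {δ y} →
      Small L δ →
      (∀ x → 0ℝ < x → x * exp y < x * pw L) → Preserving δ P → HasWideClass y P
    -- The index comes from approximate comparisons; double negations enter only the refutation of
    -- the case that every class is narrow.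
    wide-class {δ} {y} small exp-< preserving = conclude (search-⊎ λ i →
      cotransitive (ℓ i * exp y) (ℓ i * pw L) (r i) (exp-< (ℓ i) (0<ℓ i)))
      where
      conclude : HasWideClass y P ⊎ (∀ i → r i ≤ ℓ i * pw L) → HasWideClass y P
      conclude (inj₁ found) = found
      conclude (inj₂ r≤)    = ⊥-elim (narrow-absurd {δ} small preserving r≤)

  witness : ∀ {δ y} →
    Small L δ →
    (∀ x → 0ℝ < x → x * exp y < x * pw L) →
    Σ[ G ∈ WeightedGraph ] (∀ (P : WeightPartition G) → Preserving δ P → HasWideClass y P)
  witness {δ} {y} small exp-< = G , λ P → wide-class P {δ} {y} small exp-<

fromℚ-positive : ∀ {q} → 0ℚ <ᵠ q → 0ℝ < fromℚ q
fromℚ-positive {q} 0<q = q , 0<q , 0 , λ _ → ℚₚ.≤-reflexive (ℚₚ.+-identityˡ q)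

claimB1 :
    ∃[ c ] ∃[ δ₀ ] 0ℝ < c × 0ℝ < δ₀ ×
      (∀ (δ : ℝ) → {{0<δ : 0ℝ < δ}} → δ ≤ δ₀ →
        Σ[ G ∈ WeightedGraph ]
          let open WeightedGraph G
              open Matching G
          in ∀ (P : WeightPartition G) →
             let open WeightPartition P
             in (∀ (M : Fin k → Subset ∣E∣) →
                   (∀ i → IsMaxWeightMatchingOf (class i) (M i)) →
                   (1ℝ - δ) * μ ⊤ ≤ μ (⋃ (tabulate M))) →
                ∃[ i ] ℓ i * exp (c * δ ⁻¹) ≤ r i)
claimB1 = fromℚ c₀ , fromℚ δ₁ ,
  fromℚ-positive {c₀} (ℚₚ.positive⁻¹ c₀) , fromℚ-positive {δ₁} (ℚₚ.positive⁻¹ δ₁) ,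
  λ δ {{0<δ}} δ≤δ₀ →
    let open Bounds (parameters δ 0<δ δ≤δ₀)
    in LowerBound.witness L {δ} {fromℚ c₀ * δ ⁻¹} small (λ x → exp-< x)
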